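{- There exists an absolute constant $c>0$ such that the following holds. For every $\varepsilon>0$ there is $n_0=n_0(\varepsilon)$ such that for every $n\ge n_0$ and every $n$-vertex graph $F$ with maximum degree $\Delta(F)\le(1-\varepsilon)n$ and no isolated vertices, every 2-coloring $f:E(K_n)\to\{\pm1\}$ admits a copy of $F$ in $K_n$ with discrepancy at least $c\cdot\varepsilon n$.
   Context: For a coloring $f:E(K_n)\to\{\pm1\}$ and a subgraph $F_0\subseteq K_n$, the discrepancy of $F_0$ is $\left|\sum_{e\in E(F_0)}f(e)\right|$. A copy of $F$ in $K_n$ is a subgraph of $K_n$ isomorphic to $F$. -}

module Defs where

open import Level using (0ℓ)
open import Data.Nat.Base using (ℕ)
open import Data.Integer.Base as ℤ using (ℤ; +_; 0ℤ; ∣_∣; _◃_)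
open import Data.Rational.Base using (ℚ; _/_)
open import Data.Sign.Base using (Sign)
open import Data.Fin.Base using (Fin)
open import Data.Fin.Properties using (_<?_)
open import Data.Fin.Subset using (Subset; _∈_)
open import Data.List.Base using (List; allFin; cartesianProduct; filter; foldr; length; map)
open import Data.List.Extrema.Nat using (max)
open import Data.Product.Base using (∃; _×_; _,_; proj₁; uncurry)
open import Function.Base using (_∘_)
open import Function.Bundles using (_↔_; _⇔_; Inverse)
open import Relation.Binary.Core using (Rel)
open import Relation.Binary.Definitions using (Symmetric; Irreflexive; Decidable)
open import Relation.Binary.PropositionalEquality using (_≡_; _≢_; ≢-sym)
open import Relation.Nullary.Decidable using (¬?; _×-dec_)
import Data.Fin.Properties as Fin

fromℕ : ℕ → ℚ
fromℕ n = + n / 1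

record Graph (n : ℕ) : Set₁ where
  field
    Adj    : Rel (Fin n) 0ℓ
    sym    : Symmetric Adj
    irrefl : Irreflexive _≡_ Adj
    adj?   : Decidable Adj

  degree : Fin n → ℕ
  degree v = length (filter (adj? v) (allFin n))

  maxDegree : ℕ
  maxDegree = max 0 (map degree (allFin n))

  NoIsolatedVertices : Set
  NoIsolatedVertices = ∀ v → ∃ λ u → Adj v u

complete : (n : ℕ) → Graph n
complete n = record
  { Adj    = _≢_
  ; sym    = ≢-sym
  ; irrefl = λ u≡v u≢v → u≢v u≡v
  ; adj?   = λ u v → ¬? (u Fin.≟ v)
  }

record Subgraph {n : ℕ} (G : Graph n) : Set₁ where
  field
    vertices : Subset n
    Adj      : Rel (Fin n) 0ℓ
    sym      : Symmetric Adj
    adj?     : Decidable Adj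
    Adj⇒∈    : ∀ {u v} → Adj u v → u ∈ vertices
    Adj⇒G    : ∀ {u v} → Adj u v → Graph.Adj G u v

  Vertex : Set
  Vertex = ∃ λ v → v ∈ vertices

  -- Each undirected edge is listed exactly once, smaller endpoint first.
  edges : List (Fin n × Fin n)
  edges = filter (λ (u , v) → (u <? v) ×-dec adj? u v)
                 (cartesianProduct (allFin n) (allFin n))

record IsCopyOf {m n : ℕ} {G : Graph n} (F : Graph m) (H : Subgraph G) : Set where
  field
    bijection : Fin m ↔ Subgraph.Vertex H

  φ : Fin m → Fin n
  φ = proj₁ ∘ Inverse.to bijection

  field
    adj⇔ : ∀ u v → Graph.Adj F u v ⇔ Subgraph.Adj H (φ u) (φ v)

-- A ±1-colouring of the edges of the complete graph on Fin n, as a symmetric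
-- function of the two endpoints.  The values on the diagonal are meaningless
-- and never used.
record Colouring (n : ℕ) : Set where
  field
    colour     : Fin n → Fin n → Sign
    colour-sym : ∀ u v → colour u v ≡ colour v u

  value : Fin n → Fin n → ℤ
  value u v = colour u v ◃ 1

discrepancy : {n : ℕ} → Colouring n → Subgraph (complete n) → ℕ
discrepancy f H =
  ∣ foldr ℤ._+_ 0ℤ (map (uncurry (Colouring.value f)) (Subgraph.edges H)) ∣

{-# OPTIONS --safe #-}

-- Let a be the 0/1 adjacency matrix of F, and D π = Σ a(u,v) f(π u, π v) twice
-- the signed discrepancy of the copy placed by the bijection π.  Suppose that
-- |D| is small everywhere.
--
-- On the side of the colouring, averaging D over π shows that f has mean close
-- to 0, so f(x,y) and f(z,w) are nearly uncorrelated for random distinct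
-- x, y, z, w.  Hence the alternating sum f(x,z) − f(y,z) − f(x,w) + f(y,w) is
-- non-zero with probability bounded below: two disjoint paths with two edges of
-- different colours always produce such a sum, and without such paths disjoint
-- edges would be positively correlated.
--
-- On the side of F, a greedy choice gives an involution τ with Ω(εn) pairs
-- {u , τ u} and fixed points z, w of τ such that the same alternating sum of a
-- at (u , τ u ; z , w) is non-zero.  If the choice stalls early, the degree
-- condition forces the unused vertices to be independent, and then a neighbour
-- z of an unused u and an unused non-neighbour v of z give such pairs (u , v).
--
-- The difference D π − D (π τ) splits into terms T u, one for each pair, which
-- change sign when only this pair is switched in π.  Switching the right pairs
-- makes all the terms positive, so Σ |T u| = O(max |D|) for every π.  Exchanging
-- z and w changes T u by twice the product of the two alternating sums, so the
-- average of |T u| is bounded below, and max |D| = Ω(εn).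

module Submission where

open import Defs
open import Data.Nat.Base as ℕ using (ℕ; zero; suc; z≤n; s≤s)
import Data.Nat.DivMod as ℕ
import Data.Nat.Properties as ℕ
open import Data.Product.Base using (∃; _×_; _,_; proj₁; proj₂; uncurry)
open import Data.Integer.Base as ℤ using (ℤ; +_; -[1+_]; 0ℤ; 1ℤ; +≤+; -≤+; +<+)
import Data.Integer.Properties as ℤ
open import Data.Integer.Tactic.RingSolver using (solve-∀)
open import Relation.Binary.PropositionalEquality

module Combinatorics where

  open import Algebra.Bundles using (CommutativeRing)
  import Algebra.Properties.Semiring.Sum (CommutativeRing.semiring ℤ.+-*-commutativeRing) as Sum
  open import Data.Bool.Base using (Bool; true; false; if_then_else_)
  open import Data.Empty using (⊥)
  open import Data.Fin.Base as Fin
    using (Fin; zero; suc; finToFun; funToFin; combine; inject≤; punchOut; fromℕ<)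
  open import Data.Fin.Patterns
  open import Data.Fin.Permutation as Perm using (Permutation′; _⟨$⟩ʳ_; _⟨$⟩ˡ_; permutation)
  open import Data.Fin.Permutation.Components using (transpose)
  open import Data.Fin.Properties as Fin
    using (_≟_; all?; any?; suc-injective; 0≢1+n; funToFin-finToFin; finToFun-funToFin
          ; inject≤-injective; punchOut-injective; injective⇒≤)
  import Data.Fin.Subset as Subset
  open import Data.Fin.Subset.Properties using (∈⊤)
  open import Data.Integer.Base
    using (∣_∣; _◃_; _+_; _*_; _-_; -_; _≤_; _<_; nonNegative; positive; ≢-nonZero)
  open import Data.List.Base
    using (List; []; _∷_; _++_; allFin; tabulate; cartesianProduct; filter; foldr; map; length; lookup)
  open import Data.List.Extrema ℕ.≤-totalOrder using (xs≤max)
  open import Data.List.Membership.Propositional using (_∈_; _∉_)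
  open import Data.List.Membership.Propositional.Properties
    using (∈-++⁺ˡ; ∈-++⁺ʳ; ∈-filter⁺; ∈-allFin; ∈-map⁺)
  open import Data.List.Properties using (length-++; map-++; map-∘; map-tabulate)
  import Data.List.Relation.Unary.All as ListAll
  open import Data.List.Relation.Unary.Any using (here; there; index)
  open import Data.List.Relation.Unary.Any.Properties using (lookup-index)
  open import Data.Sign.Base using (Sign)
  open import Data.Sum.Base using (_⊎_; inj₁; inj₂)
  open import Data.Vec.Base as Vec using ([]; _∷_)
  open import Data.Vec.Properties.WithK using ([]=-irrelevant)
  import Data.Vec.Relation.Unary.All as All
  import Data.Vec.Relation.Unary.AllPairs as AllPairs
  open import Data.Vec.Relation.Unary.Unique.Propositional.Properties using (lookup-injective)
  open import Function.Base using (_∘_; id)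
  open import Function.Bundles using (mk⇔; mk↔ₛ′)
  open import Relation.Binary.Definitions using (Tri; tri<; tri≈; tri>)
  open import Relation.Nullary using (¬_; Dec; yes; no; does; contradiction)
  open import Relation.Nullary.Decidable
    using (_→-dec_; _×-dec_; ¬?; map′; from-yes; dec-true; dec-false; decidable-stable)

  private variable
    k n : ℕ

  -- Order and absolute value in the integers.

  -- The format of the nonlinear estimates below: the ring solver rewrites the difference as a
  -- combination of terms already known to be nonnegative.
  ≤-by : ∀ {x y z} → y - x ≡ z → 0ℤ ≤ z → x ≤ y
  ≤-by eq 0≤z = ℤ.0≤i-j⇒j≤i (subst (0ℤ ≤_) (sym eq) 0≤z)

  0≤-of : ∀ {x y} → x ≤ y → 0ℤ ≤ y - x
  0≤-of = ℤ.i≤j⇒0≤j-i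

  0≤+ : ∀ {x y} → 0ℤ ≤ x → 0ℤ ≤ y → 0ℤ ≤ x + y
  0≤+ = ℤ.+-mono-≤

  0≤* : ∀ {x y} → 0ℤ ≤ x → 0ℤ ≤ y → 0ℤ ≤ x * y
  0≤* {x} {y} 0≤x 0≤y =
    subst (_≤ x * y) (ℤ.*-zeroʳ x) (ℤ.*-monoˡ-≤-nonNeg x {{nonNegative 0≤x}} 0≤y)

  0≤+n : ∀ {m} → 0ℤ ≤ + m
  0≤+n = +≤+ z≤n

  ≤+ˡ : ∀ {x y} → 0ℤ ≤ y → x ≤ x + y
  ≤+ˡ {x} {y} 0≤y = subst (_≤ x + y) (ℤ.+-identityʳ x) (ℤ.+-monoʳ-≤ x 0≤y)

  ≤+ʳ : ∀ {x y z} → 0ℤ ≤ x → z ≤ y → z ≤ x + y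
  ≤+ʳ {z = z} 0≤x z≤y = subst (_≤ _) (ℤ.+-identityˡ z) (ℤ.+-mono-≤ 0≤x z≤y)

  cancel-≤ : ∀ k {x y} → 1ℤ ≤ k → k * x ≤ k * y → x ≤ y
  cancel-≤ k 1≤k = ℤ.*-cancelˡ-≤-pos _ _ k {{positive (ℤ.<-≤-trans (+<+ (s≤s z≤n)) 1≤k)}}

  abs : ℤ → ℤ
  abs x = + ∣ x ∣

  abs-- : ∀ x y → abs (x - y) ≤ abs x + abs y
  abs-- x y = +≤+ (ℤ.∣i-j∣≤∣i∣+∣j∣ x y)

  abs-* : ∀ x y → abs (x * y) ≡ abs x * abs y
  abs-* x y = trans (cong +_ (ℤ.abs-* x y)) (ℤ.pos-* ∣ x ∣ ∣ y ∣)

  ≤-abs : ∀ x → x ≤ abs x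
  ≤-abs (+ m)      = ℤ.≤-refl
  ≤-abs (-[1+ m ]) = -≤+

  neg≤-abs : ∀ x → - x ≤ abs x
  neg≤-abs x = subst (- x ≤_) (cong +_ (ℤ.∣-i∣≡∣i∣ x)) (≤-abs (- x))

  abs-≤ : ∀ {x b} → x ≤ b → - x ≤ b → abs x ≤ b
  abs-≤ {x} x≤b -x≤b with ℤ.+∣i∣≡i⊎+∣i∣≡-i x
  ... | inj₁ eq = subst (_≤ _) (sym eq) x≤b
  ... | inj₂ eq = subst (_≤ _) (sym eq) -x≤b

  -- Finite sums.

  opaque
    ∑ : (Fin n → ℤ) → ℤ
    ∑ = Sum.sum

    ∑-zero : (f : Fin 0 → ℤ) → ∑ f ≡ 0ℤ
    ∑-zero f = refl

    ∑-suc : (f : Fin (suc n) → ℤ) → ∑ f ≡ f zero + ∑ (f ∘ suc)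
    ∑-suc f = refl

    ∑-cong : {f g : Fin n → ℤ} → (∀ i → f i ≡ g i) → ∑ f ≡ ∑ g
    ∑-cong = Sum.sum-cong-≗

    ∑-+ : (f g : Fin n → ℤ) → ∑ (λ i → f i + g i) ≡ ∑ f + ∑ g
    ∑-+ = Sum.∑-distrib-+

    ∑-scale : ∀ c (f : Fin n → ℤ) → ∑ (λ i → c * f i) ≡ c * ∑ f
    ∑-scale c f = sym (Sum.*-distribˡ-sum c f)

    ∑-comm : ∀ {m} (F : Fin m → Fin n → ℤ) → ∑ (λ i → ∑ (F i)) ≡ ∑ (λ j → ∑ (λ i → F i j))
    ∑-comm = Sum.∑-comm

    ∑-permute : ∀ (f : Fin n → ℤ) (σ : Permutation′ n) → ∑ f ≡ ∑ (λ i → f (σ ⟨$⟩ʳ i))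
    ∑-permute = Sum.sum-permute

    ∑-mono : {f g : Fin n → ℤ} → (∀ i → f i ≤ g i) → ∑ f ≤ ∑ g
    ∑-mono {zero}  f≤g = ℤ.≤-refl
    ∑-mono {suc n} f≤g = ℤ.+-mono-≤ (f≤g zero) (∑-mono (f≤g ∘ suc))

    ∑-const : ∀ n c → ∑ {n} (λ _ → c) ≡ + n * c
    ∑-const zero    c = sym (ℤ.*-zeroˡ c)
    ∑-const (suc n) c = trans (cong (λ x → c + x) (∑-const n c)) (lem c (+ n))
      where
      lem : ∀ c m → c + m * c ≡ (+ 1 + m) * c
      lem = solve-∀

  ∑-0 : ∀ n → ∑ {n} (λ _ → 0ℤ) ≡ 0ℤ
  ∑-0 n = trans (∑-const n 0ℤ) (ℤ.*-zeroʳ (+ n))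

  ∑-nonneg : {f : Fin n → ℤ} → (∀ i → 0ℤ ≤ f i) → 0ℤ ≤ ∑ f
  ∑-nonneg {n} {f} 0≤f = subst (_≤ ∑ f) (∑-0 n) (∑-mono 0≤f)

  term≤∑ : {f : Fin n → ℤ} → (∀ i → 0ℤ ≤ f i) → ∀ j → f j ≤ ∑ f
  term≤∑ {suc n} {f} 0≤f zero    = subst₂ _≤_ (ℤ.+-identityʳ (f zero)) (sym (∑-suc f))
    (ℤ.+-monoʳ-≤ (f zero) (∑-nonneg (0≤f ∘ suc)))
  term≤∑ {suc n} {f} 0≤f (suc j) = subst₂ _≤_ (ℤ.+-identityˡ (f (suc j))) (sym (∑-suc f))
    (ℤ.+-mono-≤ (0≤f zero) (term≤∑ (0≤f ∘ suc) j))

  ∑-- : ∀ (f g : Fin n → ℤ) → ∑ (λ i → f i - g i) ≡ ∑ f - ∑ g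
  ∑-- f g = trans (∑-+ f (λ i → - g i)) (cong (λ x → ∑ f + x)
    (trans (∑-cong (λ i → sym (ℤ.-1*i≡-i (g i)))) (trans (∑-scale (- 1ℤ) g) (ℤ.-1*i≡-i (∑ g)))))

  abs-∑ : ∀ {k} (g : Fin k → ℤ) → abs (∑ g) ≤ ∑ (λ i → abs (g i))
  abs-∑ g = abs-≤ (∑-mono (λ i → ≤-abs (g i)))
    (subst (_≤ ∑ (λ i → abs (g i))) (trans (∑-scale (- 1ℤ) g) (ℤ.-1*i≡-i (∑ g)))
      (∑-mono (λ i → subst (_≤ abs (g i)) (sym (ℤ.-1*i≡-i (g i))) (neg≤-abs (g i)))))

  -- Indicators and the Kronecker delta.

  ⟦_⟧ : {P : Set} → Dec P → ℤ
  ⟦ yes _ ⟧ = 1ℤ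
  ⟦ no  _ ⟧ = 0ℤ

  ⟦⟧-yes : ∀ {P} (d : Dec P) → P → ⟦ d ⟧ ≡ 1ℤ
  ⟦⟧-yes (yes _) p = refl
  ⟦⟧-yes (no ¬p) p = contradiction p ¬p

  ⟦⟧-no : ∀ {P} (d : Dec P) → ¬ P → ⟦ d ⟧ ≡ 0ℤ
  ⟦⟧-no (yes p) ¬p = contradiction p ¬p
  ⟦⟧-no (no _)  ¬p = refl

  ⟦⟧-nonneg : ∀ {P} (d : Dec P) → 0ℤ ≤ ⟦ d ⟧
  ⟦⟧-nonneg (yes _) = 0≤+n
  ⟦⟧-nonneg (no _)  = 0≤+n

  ⟦⟧-⇔ : ∀ {P Q} (d : Dec P) (e : Dec Q) → (P → Q) → (Q → P) → ⟦ d ⟧ ≡ ⟦ e ⟧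
  ⟦⟧-⇔ (yes p) e to from = sym (⟦⟧-yes e (to p))
  ⟦⟧-⇔ (no ¬p) e to from = sym (⟦⟧-no e (¬p ∘ from))

  δ : Fin n → Fin n → ℤ
  δ i j = ⟦ i ≟ j ⟧

  δ-suc : ∀ (i j : Fin n) → δ (suc i) (suc j) ≡ δ i j
  δ-suc i j = ⟦⟧-⇔ (suc i ≟ suc j) (i ≟ j) suc-injective (cong suc)

  ∑-δ : ∀ (f : Fin n → ℤ) j → ∑ (λ i → δ i j * f i) ≡ f j
  ∑-δ {suc n} f zero = trans (∑-suc _)
    (trans (cong₂ _+_ (ℤ.*-identityˡ (f zero))
      (trans (∑-cong (λ i → ℤ.*-zeroˡ (f (suc i)))) (∑-0 n)))
      (ℤ.+-identityʳ (f zero)))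
  ∑-δ {suc n} f (suc j) = trans (∑-suc _)
    (trans (cong₂ _+_ (ℤ.*-zeroˡ (f zero))
      (trans (∑-cong (λ i → cong (_* f (suc i)) (δ-suc i j))) (∑-δ (f ∘ suc) j)))
      (ℤ.+-identityˡ (f (suc j))))

  ∑-δ₁ : ∀ (j : Fin n) → ∑ (λ i → δ i j) ≡ 1ℤ
  ∑-δ₁ j = trans (∑-cong (λ i → sym (ℤ.*-identityʳ (δ i j)))) (∑-δ (λ _ → 1ℤ) j)

  -- Transpositions and injective tuples.

  transpose-l : ∀ (i j : Fin n) → transpose i j i ≡ j
  transpose-l i j rewrite dec-true (i ≟ i) refl = refl

  transpose-r : ∀ (i j : Fin n) → transpose i j j ≡ i
  transpose-r i j with j ≟ i
  ... | yes j≡i = j≡i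
  ... | no  _ rewrite dec-true (j ≟ j) refl = refl

  transpose-fix : ∀ {i j k : Fin n} → k ≢ i → k ≢ j → transpose i j k ≡ k
  transpose-fix {i = i} {j} {k} k≢i k≢j
    rewrite dec-false (k ≟ i) k≢i | dec-false (k ≟ j) k≢j = refl

  Inj : (Fin k → Fin n) → Set
  Inj π = ∀ i j → π i ≡ π j → i ≡ j

  -- Takes the place of function extensionality: coding a function and decoding it again returns it
  -- only pointwise.
  Ext : ((Fin k → Fin n) → ℤ) → Set
  Ext g = ∀ {π ρ} → (∀ i → π i ≡ ρ i) → g π ≡ g ρ

  inj? : (π : Fin k → Fin n) → Dec (Inj π)
  inj? π = all? λ i → all? λ j → (π i ≟ π j) →-dec (i ≟ j)

  Inj-perm : (σ : Permutation′ n) → Inj (σ ⟨$⟩ʳ_)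
  Inj-perm σ i j eq = trans (sym (Perm.inverseˡ σ)) (trans (cong (σ ⟨$⟩ˡ_) eq) (Perm.inverseˡ σ))

  Inj-∘ : ∀ {l} {t : Fin k → Fin n} {s : Fin l → Fin k} → Inj t → Inj s → Inj (t ∘ s)
  Inj-∘ it is i j eq = is i j (it _ _ eq)

  involution-Inj : ∀ (s : Fin n → Fin n) → (∀ u → s (s u) ≡ u) → Inj s
  involution-Inj s inv i j e = trans (sym (inv i)) (trans (cong s e) (inv j))

  -- Any injective tuple is carried to any other one by a permutation: match the
  -- tails by induction, then correct the head with a transposition, which does
  -- not move the tail.
  transitive : (t t′ : Fin k → Fin n) → Inj t → Inj t′ →
               ∃ λ (σ : Permutation′ n) → ∀ i → σ ⟨$⟩ʳ t i ≡ t′ i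
  transitive {zero}  t t′ it it′ = Perm.id , λ ()
  transitive {suc k} t t′ it it′
    with σ , eq ← transitive (t ∘ suc) (t′ ∘ suc) (λ i j p → suc-injective (it _ _ p)) (λ i j p → suc-injective (it′ _ _ p))
    = σ Perm.∘ₚ Perm.transpose (σ ⟨$⟩ʳ t zero) (t′ zero) , λ where
        zero    → transpose-l (σ ⟨$⟩ʳ t zero) (t′ zero)
        (suc i) → trans (cong (transpose (σ ⟨$⟩ʳ t zero) (t′ zero)) (eq i))
          (transpose-fix
            (λ p → 0≢1+n (sym (it _ _ (Inj-perm σ _ _ (trans (eq i) p)))))
            (λ p → 0≢1+n (sym (it′ _ _ p))))

  ∑-involution : ∀ (s : Fin n → Fin n) → (∀ u → s (s u) ≡ u) → ∀ f → ∑ f ≡ ∑ (f ∘ s)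
  ∑-involution s inv f = ∑-permute f (permutation s s inv inv)

  -- Double sums.

  Σ₂ : (Fin n → Fin n → ℤ) → ℤ
  Σ₂ F = ∑ λ u → ∑ λ v → F u v

  Σ₂-cong : {F G : Fin n → Fin n → ℤ} → (∀ u v → F u v ≡ G u v) → Σ₂ F ≡ Σ₂ G
  Σ₂-cong eq = ∑-cong (λ u → ∑-cong (eq u))

  Σ₂-+ : (F G : Fin n → Fin n → ℤ) → Σ₂ (λ u v → F u v + G u v) ≡ Σ₂ F + Σ₂ G
  Σ₂-+ F G = trans (∑-cong (λ u → ∑-+ (F u) (G u))) (∑-+ (λ u → ∑ (F u)) (λ u → ∑ (G u)))

  Σ₂-- : (F G : Fin n → Fin n → ℤ) → Σ₂ (λ u v → F u v - G u v) ≡ Σ₂ F - Σ₂ G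
  Σ₂-- F G = trans (∑-cong (λ u → ∑-- (F u) (G u))) (∑-- (λ u → ∑ (F u)) (λ u → ∑ (G u)))

  Σ₂-swap : (F : Fin n → Fin n → ℤ) → Σ₂ F ≡ Σ₂ (λ u v → F v u)
  Σ₂-swap F = ∑-comm F

  Σ₂-involution : ∀ (s : Fin n → Fin n) → (∀ u → s (s u) ≡ u) → ∀ F → Σ₂ F ≡ Σ₂ (λ u v → F (s u) (s v))
  Σ₂-involution s inv F = trans (∑-cong (λ u → ∑-involution s inv (F u)))
    (∑-involution s inv (λ u → ∑ (λ v → F u (s v))))

  Σ₂-mono : {F G : Fin n → Fin n → ℤ} → (∀ u v → F u v ≤ G u v) → Σ₂ F ≤ Σ₂ G
  Σ₂-mono le = ∑-mono (λ u → ∑-mono (le u))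

  Σ₂-scale : ∀ c (F : Fin n → Fin n → ℤ) → Σ₂ (λ u v → c * F u v) ≡ c * Σ₂ F
  Σ₂-scale c F = trans (∑-cong (λ u → ∑-scale c (F u))) (∑-scale c (λ u → ∑ (F u)))

  Σ₂-const : ∀ n c → Σ₂ {n} (λ _ _ → c) ≡ + n * (+ n * c)
  Σ₂-const n c = trans (∑-cong (λ _ → ∑-const n c)) (∑-const n (+ n * c))

  ∑-scale-δ : ∀ c (j : Fin n) → ∑ (λ i → c * δ i j) ≡ c
  ∑-scale-δ c j = trans (∑-scale c (λ i → δ i j)) (trans (cong (c *_) (∑-δ₁ j)) (ℤ.*-identityʳ c))

  -- Averages over all bijections.

  module Average (n : ℕ) where

    private V = Fin n

    weight : (V → V) → ℤ
    weight π = ⟦ inj? π ⟧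

    weight-ext : Ext weight
    weight-ext {π} {ρ} eq = ⟦⟧-⇔ (inj? π) (inj? ρ)
      (λ p i j e → p i j (trans (eq i) (trans e (sym (eq j)))))
      (λ p i j e → p i j (trans (sym (eq i)) (trans e (eq j))))

    weight-perm : ∀ π (σ : Permutation′ n) → weight (π ∘ (σ ⟨$⟩ʳ_)) ≡ weight π
    weight-perm π σ = ⟦⟧-⇔ (inj? _) (inj? π)
      (λ p i j e → trans (sym (Perm.inverseʳ σ)) (trans (cong (σ ⟨$⟩ʳ_)
         (p (σ ⟨$⟩ˡ i) (σ ⟨$⟩ˡ j) (trans (cong π (Perm.inverseʳ σ)) (trans e (cong π (sym (Perm.inverseʳ σ)))))))
         (Perm.inverseʳ σ)))
      (λ p → Inj-∘ p (Inj-perm σ))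

    private
      fun : Fin (n ℕ.^ n) → V → V
      fun = finToFun {n} {n}

      code : (V → V) → Fin (n ℕ.^ n)
      code = funToFin {n} {n}

      fun-code : ∀ p i → fun (code p) i ≡ p i
      fun-code = finToFun-funToFin

    opaque
      -- The sum of g over all bijections of V, which is n! times the average of g
      -- over a uniformly random one; the remaining functions get weight 0.
      E : ((V → V) → ℤ) → ℤ
      E g = ∑ λ i → weight (fun i) * g (fun i)

      E-cong : ∀ {g h} → (∀ π → g π ≡ h π) → E g ≡ E h
      E-cong eq = ∑-cong (λ i → cong (weight (fun i) *_) (eq (fun i)))

      E-mono : ∀ {g h} → (∀ π → Inj π → g π ≤ h π) → E g ≤ E h
      E-mono {g} {h} le = ∑-mono λ i → aux (fun i)
        where
        aux : ∀ π → weight π * g π ≤ weight π * h π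
        aux π with inj? π
        ... | yes p = subst₂ _≤_ (sym (ℤ.*-identityˡ _)) (sym (ℤ.*-identityˡ _)) (le π p)
        ... | no  _ = ℤ.≤-refl

      E-+ : ∀ g h → E (λ π → g π + h π) ≡ E g + E h
      E-+ g h = trans (∑-cong (λ i → ℤ.*-distribˡ-+ (weight (fun i)) (g (fun i)) (h (fun i)))) (∑-+ _ _)

      E-* : ∀ c g → E (λ π → c * g π) ≡ c * E g
      E-* c g = trans (∑-cong (λ i → lem (weight (fun i)) c (g (fun i)))) (∑-scale c _)
        where
        lem : ∀ w c x → w * (c * x) ≡ c * (w * x)
        lem = solve-∀

      E-∑ : ∀ {m} (g : Fin m → (V → V) → ℤ) → E (λ π → ∑ (λ v → g v π)) ≡ ∑ (λ v → E (g v))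
      E-∑ g = trans (∑-cong (λ i → sym (∑-scale (weight (fun i)) (λ v → g v (fun i))))) (∑-comm _)

      -- Precomposition with σ permutes the codes of functions and preserves `weight`, so it only
      -- reorders the sum.
      E-permute : ∀ {g} → Ext g → (σ : Permutation′ n) → E (λ π → g (π ∘ (σ ⟨$⟩ʳ_))) ≡ E g
      E-permute {g} ext σ = sym (trans
        (∑-permute (λ i → weight (fun i) * g (fun i)) reindexing)
        (∑-cong (λ i → cong₂ _*_
          (trans (weight-ext (fun-code (fun i ∘ (σ ⟨$⟩ʳ_)))) (weight-perm (fun i) σ))
          (ext (fun-code (fun i ∘ (σ ⟨$⟩ʳ_)))))))
        where
        funToFin-cong : ∀ {k} {p q : Fin k → V} → (∀ i → p i ≡ q i) → funToFin p ≡ funToFin q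
        funToFin-cong {zero}  eq = refl
        funToFin-cong {suc k} eq = cong₂ combine (eq zero) (funToFin-cong (eq ∘ suc))

        reindex : (V → V) → Fin (n ℕ.^ n) → Fin (n ℕ.^ n)
        reindex s i = code (fun i ∘ s)

        reindex-inv : ∀ s s′ → (∀ i → s (s′ i) ≡ i) → ∀ i → reindex s′ (reindex s i) ≡ i
        reindex-inv s s′ inv i = trans
          (funToFin-cong (λ j → trans (fun-code (fun i ∘ s) (s′ j)) (cong (fun i) (inv j))))
          (funToFin-finToFin {n} {n} i)

        reindexing : Permutation′ (n ℕ.^ n)
        reindexing = permutation (reindex (σ ⟨$⟩ʳ_)) (reindex (σ ⟨$⟩ˡ_))
          (reindex-inv (σ ⟨$⟩ˡ_) (σ ⟨$⟩ʳ_) (λ _ → Perm.inverseˡ σ))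
          (reindex-inv (σ ⟨$⟩ʳ_) (σ ⟨$⟩ˡ_) (λ _ → Perm.inverseʳ σ))

      -- The functions are enumerated by finitely many codes, so the dichotomy is decided by
      -- exhaustive search.
      search : ∀ {g} → Ext {n} {n} g → ∀ b → (∃ λ π → Inj π × b ≤ g π) ⊎ (∀ π → Inj π → g π < b)
      search {g} ext b with any? (λ i → inj? (fun i) ×-dec (b ℤ.≤? g (fun i)))
      ... | yes (i , p)  = inj₁ (fun i , p)
      ... | no ¬p = inj₂ λ π inj → ℤ.≰⇒> (λ b≤ → ¬p (code π ,
              (λ i j e → inj i j (trans (sym (fun-code π i)) (trans e (fun-code π j)))) ,
              subst (b ≤_) (ext (λ i → sym (fun-code π i))) b≤))

      -- The code of the identity alone contributes 1. This positivity is what allows `N` to be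
      -- cancelled in the final estimates.
      1≤E1 : 1ℤ ≤ E (λ _ → 1ℤ)
      1≤E1 = subst (_≤ E (λ _ → 1ℤ)) (trans (ℤ.*-identityʳ _) (⟦⟧-yes (inj? _) fun-code-inj))
        (term≤∑ {f = λ i → weight (fun i) * 1ℤ} (λ i → 0≤* {y = 1ℤ} (⟦⟧-nonneg (inj? (fun i))) 0≤+n) (code id))
        where
        fun-code-inj : Inj (fun (code id))
        fun-code-inj i j e = trans (sym (fun-code id i)) (trans e (fun-code id j))

    -- Some permutation carries `t` to `t′`, and `E` is invariant under it. Hence an average depends
    -- only on the pattern of distinct vertices, not on their choice.
    E-tuple : (h : (Fin k → V) → ℤ) → Ext h → (t t′ : Fin k → V) → Inj t → Inj t′ →
              E (λ π → h (π ∘ t)) ≡ E (λ π → h (π ∘ t′))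
    E-tuple h ext t t′ it it′ with σ , eq ← transitive t t′ it it′ =
      trans (sym (E-permute (λ p → ext (λ i → p (t i))) σ)) (E-cong (λ π → ext (λ i → cong π (eq i))))

    N : ℤ
    N = E (λ _ → 1ℤ)

    1≤N : 1ℤ ≤ N
    1≤N = 1≤E1

    E-const : ∀ c → E (λ _ → c) ≡ c * N
    E-const c = trans (E-cong (λ _ → sym (ℤ.*-identityʳ c))) (E-* c (λ _ → 1ℤ))

    E-nonneg : ∀ {g} → (∀ π → 0ℤ ≤ g π) → 0ℤ ≤ E g
    E-nonneg {g} 0≤g = subst (_≤ E g) (trans (E-const 0ℤ) (ℤ.*-zeroˡ N)) (E-mono (λ π _ → 0≤g π))

    abs-E : ∀ g → abs (E g) ≤ E (λ π → abs (g π))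
    abs-E g = abs-≤ (E-mono (λ π _ → ≤-abs (g π)))
      (subst (_≤ E (λ π → abs (g π))) (trans (E-* (- 1ℤ) g) (ℤ.-1*i≡-i (E g)))
        (E-mono (λ π _ → subst (_≤ abs (g π)) (sym (ℤ.-1*i≡-i (g π))) (neg≤-abs (g π)))))

    E-congᵢ : ∀ {g h} → (∀ π → Inj π → g π ≡ h π) → E g ≡ E h
    E-congᵢ eq = ℤ.≤-antisym (E-mono (λ π i → ℤ.≤-reflexive (eq π i)))
                             (E-mono (λ π i → ℤ.≤-reflexive (sym (eq π i))))

    E-Σ₂ : ∀ (F : V → V → (V → V) → ℤ) →
           E (λ π → Σ₂ (λ u v → F u v π)) ≡ Σ₂ (λ u v → E (F u v))
    E-Σ₂ F = trans (E-∑ (λ u π → ∑ (λ v → F u v π))) (∑-cong (λ u → E-∑ (F u)))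

  -- Switching the pairs of an involution.

  alt : (Fin n → Fin n → ℤ) → Fin n → Fin n → Fin n → Fin n → ℤ
  alt f x y z w = f x z - f y z - f x w + f y w

  module Switching {n : ℕ} (a f : Fin n → Fin n → ℤ)
    (a-sym : ∀ u v → a u v ≡ a v u) (f-sym : ∀ x y → f x y ≡ f y x) where

    open Average n
    private V = Fin n

    D : (V → V) → ℤ
    D π = Σ₂ λ u v → a u v * f (π u) (π v)

    module Involution (τ : V → V) (τ-inv : ∀ u → τ (τ u) ≡ u) where

      -- The part of a that is odd under τ in the row index and even under τ in
      -- the column index.
      g : V → V → ℤ
      g u v = a u v - a (τ u) v + a u (τ v) - a (τ u) (τ v)

      g-even : ∀ u v → g u (τ v) ≡ g u v
      g-even u v rewrite τ-inv v = lem (a u (τ v)) (a (τ u) (τ v)) (a u v) (a (τ u) v)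
        where
        lem : ∀ p q r s → p - q + r - s ≡ r - s + p - q
        lem = solve-∀

      g-odd : ∀ u v → g (τ u) v ≡ - g u v
      g-odd u v rewrite τ-inv u = lem (a u (τ v)) (a (τ u) (τ v)) (a u v) (a (τ u) v)
        where
        lem : ∀ p q r s → s - r + q - p ≡ - (r - s + p - q)
        lem = solve-∀

      -- Of the four terms of `g`, the two mixed ones cancel by symmetry of `a` and `φ`, and the
      -- last is reindexed by τ. With `φ u v = f (π u) (π v)` the right-hand side is
      -- `D π - D (π ∘ τ)`.
      Σg : ∀ (φ : V → V → ℤ) → (∀ u v → φ u v ≡ φ v u) →
           Σ₂ (λ u v → g u v * φ u v) ≡ Σ₂ (λ u v → a u v * φ u v) - Σ₂ (λ u v → a u v * φ (τ u) (τ v))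
      Σg φ φ-sym = begin
        Σ₂ (λ u v → g u v * φ u v)
          ≡⟨ Σ₂-cong (λ u v → lem (a u v) (a (τ u) v) (a u (τ v)) (a (τ u) (τ v)) (φ u v)) ⟩
        Σ₂ (λ u v → (A u v - B u v) + (B′ u v - C u v))
          ≡⟨ trans (Σ₂-+ (λ u v → A u v - B u v) (λ u v → B′ u v - C u v)) (cong₂ _+_ (Σ₂-- A B) (Σ₂-- B′ C)) ⟩
        (Σ₂ A - Σ₂ B) + (Σ₂ B′ - Σ₂ C)
          ≡⟨ cong (λ x → (Σ₂ A - Σ₂ B) + (x - Σ₂ C)) (trans (Σ₂-swap B′)
               (Σ₂-cong (λ u v → cong₂ _*_ (a-sym v (τ u)) (φ-sym v u)))) ⟩
        (Σ₂ A - Σ₂ B) + (Σ₂ B - Σ₂ C)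
          ≡⟨ lem′ (Σ₂ A) (Σ₂ B) (Σ₂ C) ⟩
        Σ₂ A - Σ₂ C
          ≡⟨ cong (λ x → Σ₂ A - x) (trans (Σ₂-involution τ τ-inv C)
               (Σ₂-cong (λ u v → cong₂ (λ x y → a x y * φ (τ u) (τ v)) (τ-inv u) (τ-inv v)))) ⟩
        Σ₂ A - Σ₂ (λ u v → a u v * φ (τ u) (τ v)) ∎
        where
        open ≡-Reasoning
        A B B′ C : V → V → ℤ
        A  u v = a u v * φ u v
        B  u v = a (τ u) v * φ u v
        B′ u v = a u (τ v) * φ u v
        C  u v = a (τ u) (τ v) * φ u v
        lem : ∀ p q r s x → (p - q + r - s) * x ≡ (p * x - q * x) + (r * x - s * x)
        lem = solve-∀
        lem′ : ∀ x y z → (x - y) + (y - z) ≡ x - z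
        lem′ = solve-∀

      G : (V → V) → V → ℤ
      G π u = ∑ λ v → g u v * f (π u) (π v)

      -- The rows of u and τ u are taken together, so a sum of `T` over all vertices counts every
      -- pair twice.
      T : (V → V) → V → ℤ
      T π u = G π u + G π (τ u)

      T-τ : ∀ π u → T π (τ u) ≡ T π u
      T-τ π u = trans (cong (λ x → G π (τ u) + G π x) (τ-inv u)) (ℤ.+-comm (G π (τ u)) (G π u))

      T-Ext : ∀ u → Ext (λ π → T π u)
      T-Ext u eq = cong₂ _+_ (∑-cong (λ v → cong₂ (λ x y → g u v * f x y) (eq u) (eq v)))
                           (∑-cong (λ v → cong₂ (λ x y → g (τ u) v * f x y) (eq (τ u)) (eq v)))

      -- Applying τ exactly on the pairs {u , τ u} where T is negative turns
      -- every T into its absolute value.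
      module _ (π : V → V) where
        negative : V → Bool
        negative u = does (T π u ℤ.<? 0ℤ)

        ε : V → ℤ
        ε u = if negative u then - 1ℤ else 1ℤ

        σ : V → V
        σ u = if negative u then τ u else u

        negative-τ : ∀ u → negative (τ u) ≡ negative u
        negative-τ u = cong (λ x → does (x ℤ.<? 0ℤ)) (T-τ π u)

        σ-inv : ∀ u → σ (σ u) ≡ u
        σ-inv u with negative u in eq
        ... | false = cong (if_then τ u else u) eq
        ... | true  = trans (cong (if_then τ (τ u) else τ u) (trans (negative-τ u) eq)) (τ-inv u)

        g-σʳ : ∀ u v → g u (σ v) ≡ g u v
        g-σʳ u v with negative v
        ... | true  = g-even u v
        ... | false = refl

        g-σˡ : ∀ u v → g (σ u) v ≡ ε u * g u v
        g-σˡ u v with negative u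
        ... | true  = trans (g-odd u v) (sym (ℤ.-1*i≡-i (g u v)))
        ... | false = sym (ℤ.*-identityˡ (g u v))

        ε-τ : ∀ u → ε (τ u) ≡ ε u
        ε-τ u = cong (if_then - 1ℤ else 1ℤ) (negative-τ u)

        ε-abs : ∀ u → ε u * T π u ≡ abs (T π u)
        ε-abs u with T π u | T π u ℤ.<? 0ℤ
        ... | x | yes x<0 = trans (ℤ.-1*i≡-i x) (sym (trans (cong +_ (sym (ℤ.∣-i∣≡∣i∣ x)))
                          (ℤ.0≤i⇒+∣i∣≡i (ℤ.neg-mono-≤ (ℤ.<⇒≤ x<0)))))
        ... | x | no  x≮0 = trans (ℤ.*-identityˡ x) (sym (ℤ.0≤i⇒+∣i∣≡i (ℤ.≮⇒≥ x≮0)))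

        -- Reindexing the difference by `σ` leaves the columns of `g` unchanged, since `g` is even
        -- there, and multiplies row u by `ε u`, since `g` is odd there. These signs turn each `T`
        -- into its absolute value; the factor 2 is the double count of pairs.
        Σ-abs : ∑ (λ u → abs (T π u)) ≡ + 2 * (D (π ∘ σ) - D (π ∘ σ ∘ τ))
        Σ-abs = begin
          ∑ (λ u → abs (T π u))
            ≡⟨ ∑-cong (λ u → trans (sym (ε-abs u)) (ℤ.*-distribˡ-+ (ε u) _ _)) ⟩
          ∑ (λ u → ε u * G π u + ε u * G π (τ u))
            ≡⟨ ∑-+ (λ u → ε u * G π u) (λ u → ε u * G π (τ u)) ⟩
          X + ∑ (λ u → ε u * G π (τ u))
            ≡⟨ cong (λ x → X + x) (trans (∑-cong (λ u → cong (_* G π (τ u)) (sym (ε-τ u))))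
                 (sym (∑-involution τ τ-inv (λ u → ε u * G π u)))) ⟩
          X + X
            ≡⟨ lem X ⟩
          + 2 * X
            ≡⟨ cong (+ 2 *_) (sym X≡) ⟩
          + 2 * (D (π ∘ σ) - D (π ∘ σ ∘ τ)) ∎
          where
          open ≡-Reasoning
          X : ℤ
          X = ∑ (λ u → ε u * G π u)
          lem : ∀ x → x + x ≡ + 2 * x
          lem = solve-∀
          X≡ : D (π ∘ σ) - D (π ∘ σ ∘ τ) ≡ X
          X≡ = begin
            D (π ∘ σ) - D (π ∘ σ ∘ τ)
              ≡⟨ sym (Σg (λ u v → f (π (σ u)) (π (σ v))) (λ u v → f-sym _ _)) ⟩
            Σ₂ (λ u v → g u v * f (π (σ u)) (π (σ v)))
              ≡⟨ Σ₂-involution σ σ-inv _ ⟩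
            Σ₂ (λ u v → g (σ u) (σ v) * f (π (σ (σ u))) (π (σ (σ v))))
              ≡⟨ Σ₂-cong (λ u v → cong₂ _*_ (trans (g-σʳ (σ u) v) (g-σˡ u v))
                   (cong₂ (λ x y → f (π x) (π y)) (σ-inv u) (σ-inv v))) ⟩
            Σ₂ (λ u v → ε u * g u v * f (π u) (π v))
              ≡⟨ ∑-cong (λ u → trans (∑-cong (λ v → ℤ.*-assoc (ε u) (g u v) (f (π u) (π v))))
                   (∑-scale (ε u) (λ v → g u v * f (π u) (π v)))) ⟩
            X ∎

      -- Two placements, each costing at most `K`, times the factor 2 of `Σ-abs`.
      Σ-abs-≤ : ∀ {K} → (∀ π → Inj π → abs (D π) ≤ K) →
                ∀ π → Inj π → ∑ (λ u → abs (T π u)) ≤ + 4 * K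
      Σ-abs-≤ {K} bound π inj = ℤ.≤-trans (ℤ.≤-reflexive (Σ-abs π))
        (≤-by (lem (D ρ) (D (ρ ∘ τ)) K) (0≤* {+ 2} 0≤+n
          (0≤+ (0≤-of (ℤ.≤-trans (≤-abs (D ρ)) (bound ρ ρ-inj)))
               (0≤-of (ℤ.≤-trans (neg≤-abs (D (ρ ∘ τ))) (bound (ρ ∘ τ) (Inj-∘ ρ-inj (involution-Inj τ τ-inv))))))))
        where
        ρ : V → V
        ρ = π ∘ σ π
        ρ-inj : Inj ρ
        ρ-inj = Inj-∘ inj (involution-Inj (σ π) (σ-inv π))
        lem : ∀ x y k → + 4 * k - + 2 * (x - y) ≡ + 2 * ((k - x) + (k - (- y)))
        lem = solve-∀

      module _ {u z w : V} (z≢w : z ≢ w) (z≢u : z ≢ u) (w≢u : w ≢ u)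
               (τz : τ z ≡ z) (τw : τ w ≡ w) where

        private
          s : V → V
          s = transpose z w

          fixed≢τ : ∀ {x} → x ≢ u → τ x ≡ x → x ≢ τ u
          fixed≢τ x≢u τx x≡τu = x≢u (trans (sym τx) (trans (cong τ x≡τu) (τ-inv u)))

          su : s u ≡ u
          su = transpose-fix (z≢u ∘ sym) (w≢u ∘ sym)

          sτu : s (τ u) ≡ τ u
          sτu = transpose-fix (fixed≢τ z≢u τz ∘ sym) (fixed≢τ w≢u τw ∘ sym)

          Δ : (V → V) → V → ℤ
          Δ π v = f (π u) (π v) - f (π (τ u)) (π v)

          T≡ : ∀ π → T π u ≡ ∑ (λ v → g u v * Δ π v)
          T≡ π = trans (sym (∑-+ (λ v → g u v * f (π u) (π v)) (λ v → g (τ u) v * f (π (τ u)) (π v)))) (∑-cong (λ v →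
            trans (cong (λ x → g u v * f (π u) (π v) + x * f (π (τ u)) (π v)) (g-odd u v))
                  (lem (g u v) (f (π u) (π v)) (f (π (τ u)) (π v)))))
            where
            lem : ∀ c x y → c * x + - c * y ≡ c * (x - y)
            lem = solve-∀

          Δ∘s : ∀ π v → Δ (π ∘ s) v ≡ Δ π (s v)
          Δ∘s π v = cong₂ (λ x y → f (π x) (π (s v)) - f (π y) (π (s v))) su sτu

          Δ-diff : ∀ π v → Δ π v - Δ π (s v) ≡ (δ v z - δ v w) * (Δ π z - Δ π w)
          Δ-diff π v = aux v (v ≟ z) (v ≟ w)
            where
            lem : ∀ x y → y - x ≡ (0ℤ - 1ℤ) * (x - y)
            lem = solve-∀
            aux : ∀ v (d : Dec (v ≡ z)) (e : Dec (v ≡ w)) →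
                  Δ π v - Δ π (s v) ≡ (⟦ d ⟧ - ⟦ e ⟧) * (Δ π z - Δ π w)
            aux v (yes refl) (yes e)  = contradiction e z≢w
            aux v (yes refl) (no _)   = trans (cong (λ x → Δ π z - Δ π x) (transpose-l z w)) (sym (ℤ.*-identityˡ _))
            aux v (no _) (yes refl)   = trans (cong (λ x → Δ π w - Δ π x) (transpose-r z w)) (lem (Δ π z) (Δ π w))
            aux v (no v≢z) (no v≢w)   = trans (cong (λ x → Δ π v - Δ π x) (transpose-fix v≢z v≢w)) (ℤ.+-inverseʳ (Δ π v))

        -- The transposition fixes u and τ u, so only the columns z and w change. Both are fixed by
        -- τ, where `g u` doubles the difference of the two rows of `a`; hence the factor 2.
        T-transpose : ∀ π → T π u - T (π ∘ s) u ≡ + 2 * (alt a u (τ u) z w * alt f (π u) (π (τ u)) (π z) (π w))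
        T-transpose π = begin
          T π u - T (π ∘ s) u
            ≡⟨ cong₂ _-_ (T≡ π) (trans (T≡ (π ∘ s)) (∑-cong (λ v → cong (g u v *_) (Δ∘s π v)))) ⟩
          ∑ (λ v → g u v * Δ π v) - ∑ (λ v → g u v * Δ π (s v))
            ≡⟨ sym (∑-- (λ v → g u v * Δ π v) (λ v → g u v * Δ π (s v))) ⟩
          ∑ (λ v → g u v * Δ π v - g u v * Δ π (s v))
            ≡⟨ ∑-cong (λ v → trans (lem₁ (g u v) (Δ π v) (Δ π (s v)))
                 (trans (cong (g u v *_) (Δ-diff π v)) (lem₂ (g u v) (δ v z) (δ v w) (Δ π z - Δ π w)))) ⟩
          ∑ (λ v → δ v z * (g u v * (Δ π z - Δ π w)) - δ v w * (g u v * (Δ π z - Δ π w)))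
            ≡⟨ trans (∑-- (λ v → δ v z * (g u v * (Δ π z - Δ π w))) (λ v → δ v w * (g u v * (Δ π z - Δ π w)))) (cong₂ _-_ (∑-δ (λ v → g u v * (Δ π z - Δ π w)) z)
                                            (∑-δ (λ v → g u v * (Δ π z - Δ π w)) w)) ⟩
          g u z * (Δ π z - Δ π w) - g u w * (Δ π z - Δ π w)
            ≡⟨ cong₂ (λ x y → (a u z - a (τ u) z + a u x - a (τ u) x) * (Δ π z - Δ π w)
                            - (a u w - a (τ u) w + a u y - a (τ u) y) * (Δ π z - Δ π w)) τz τw ⟩
          (a u z - a (τ u) z + a u z - a (τ u) z) * (Δ π z - Δ π w)
            - (a u w - a (τ u) w + a u w - a (τ u) w) * (Δ π z - Δ π w)
            ≡⟨ lem₃ (a u z) (a (τ u) z) (a u w) (a (τ u) w) (f (π u) (π z)) (f (π (τ u)) (π z)) (f (π u) (π w)) (f (π (τ u)) (π w)) ⟩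
          + 2 * (alt a u (τ u) z w * alt f (π u) (π (τ u)) (π z) (π w)) ∎
          where
          open ≡-Reasoning
          lem₁ : ∀ c x y → c * x - c * y ≡ c * (x - y)
          lem₁ = solve-∀
          lem₂ : ∀ c d e x → c * ((d - e) * x) ≡ d * (c * x) - e * (c * x)
          lem₂ = solve-∀
          lem₃ : ∀ p q r t x y i j → (p - q + p - q) * ((x - y) - (i - j)) - (r - t + r - t) * ((x - y) - (i - j))
                   ≡ + 2 * ((p - q - r + t) * (x - y - i + j))
          lem₃ = solve-∀

        -- A nonzero integer has absolute value at least 1, so `T-transpose` bounds twice the
        -- alternating sum of `f` by `|T|` at π plus `|T|` at `π ∘ s`. The two have the same
        -- average.
        E-alt≤E-T : alt a u (τ u) z w ≢ 0ℤ →
                    E (λ π → abs (alt f (π u) (π (τ u)) (π z) (π w))) ≤ E (λ π → abs (T π u))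
        E-alt≤E-T alt≢0 = ℤ.*-cancelˡ-≤-pos _ _ (+ 2) (begin
          + 2 * E q                                     ≡⟨ sym (E-* (+ 2) q) ⟩
          E (λ π → + 2 * q π)                           ≤⟨ E-mono (λ π _ → pointwise π) ⟩
          E (λ π → abs (T π u) + abs (T (π ∘ s) u))     ≡⟨ E-+ |T| (λ π → abs (T (π ∘ s) u)) ⟩
          E |T| + E (λ π → abs (T (π ∘ s) u))           ≡⟨ cong (λ x → E |T| + x) (E-permute (λ eq → cong abs (T-Ext u eq)) (Perm.transpose z w)) ⟩
          E |T| + E |T|                                 ≡⟨ lem (E |T|) ⟩
          + 2 * E |T|                                   ∎)
          where
          open ℤ.≤-Reasoning
          q |T| : (V → V) → ℤ
          q π = abs (alt f (π u) (π (τ u)) (π z) (π w))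
          |T| π = abs (T π u)
          lem : ∀ x → x + x ≡ + 2 * x
          lem = solve-∀
          c : ℤ
          c = alt a u (τ u) z w
          1≤c : 1ℤ ≤ abs c
          1≤c = +≤+ (ℕ.>-nonZero⁻¹ ∣ c ∣ {{≢-nonZero alt≢0}})
          pointwise : ∀ π → + 2 * q π ≤ abs (T π u) + abs (T (π ∘ s) u)
          pointwise π = begin
            + 2 * q π                 ≡⟨ cong (+ 2 *_) (sym (ℤ.*-identityˡ (q π))) ⟩
            + 2 * (1ℤ * q π)          ≤⟨ ℤ.*-monoˡ-≤-nonNeg (+ 2) (ℤ.*-monoʳ-≤-nonNeg (q π) 1≤c) ⟩
            + 2 * (abs c * q π)       ≡⟨ sym (trans (abs-* (+ 2) (c * _)) (cong (+ 2 *_) (abs-* c _))) ⟩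
            abs (+ 2 * (c * alt f (π u) (π (τ u)) (π z) (π w))) ≡⟨ cong abs (sym (T-transpose π)) ⟩
            abs (T π u - T (π ∘ s) u) ≤⟨ abs-- (T π u) (T (π ∘ s) u) ⟩
            abs (T π u) + abs (T (π ∘ s) u) ∎

  -- Injective self-maps as permutations.

  -- Pigeonhole: punching out a missed value would inject `Fin (suc n)` into `Fin n`.
  Inj⇒surjective : {π : Fin n → Fin n} → Inj π → ∀ y → ∃ λ x → π x ≡ y
  Inj⇒surjective {suc n} {π} inj y with any? (λ x → π x ≟ y)
  ... | yes p = p
  ... | no ¬p = contradiction
    (injective⇒≤ {f = λ x → punchOut (y≢π x)} (λ {x} {x′} e → inj x x′ (punchOut-injective (y≢π x) (y≢π x′) e)))
    ℕ.1+n≰n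
    where
    y≢π : ∀ x → y ≢ π x
    y≢π x y≡πx = ¬p (x , sym y≡πx)

  Inj⇒permutation : (π : Fin n → Fin n) → Inj π → Permutation′ n
  Inj⇒permutation π inj = permutation π (proj₁ ∘ Inj⇒surjective inj) (proj₂ ∘ Inj⇒surjective inj)
    (λ x → inj _ _ (proj₂ (Inj⇒surjective inj (π x))))

  Σ₂-Inj : (π : Fin n → Fin n) → Inj π → ∀ F → Σ₂ (λ u v → F (π u) (π v)) ≡ Σ₂ F
  Σ₂-Inj π inj F = sym (trans (∑-cong (λ x → ∑-permute (F x) σ)) (∑-permute (λ x → ∑ (λ v → F x (π v))) σ))
    where σ = Inj⇒permutation π inj

  -- Inequalities between signs.

  -- Makes the sign inequalities below decidable, so that they are proved by evaluating all cases,
  -- at most 256 of them.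
  ∀Sign? : {P : Sign → Set} → (∀ s → Dec (P s)) → Dec (∀ s → P s)
  ∀Sign? P? = map′ (λ { (p , q) Sign.+ → p ; (p , q) Sign.- → q }) (λ f → f Sign.+ , f Sign.-)
    (P? Sign.+ ×-dec P? Sign.-)

  ⟪_⟫ : Sign → ℤ
  ⟪ s ⟫ = s ◃ 1

  abs-⟪⟫ : ∀ s → abs ⟪ s ⟫ ≡ 1ℤ
  abs-⟪⟫ Sign.+ = refl
  abs-⟪⟫ Sign.- = refl

  -- Twice the indicator that the signs differ.
  differ : Sign → Sign → ℤ
  differ s t = 1ℤ - ⟪ s ⟫ * ⟪ t ⟫

  ∣alt∣ : Sign → Sign → Sign → Sign → ℤ
  ∣alt∣ p q r s = abs (⟪ p ⟫ - ⟪ q ⟫ - ⟪ r ⟫ + ⟪ s ⟫)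

  -- If the paths c b a and c′ b′ a′ are both bichromatic, then one of the three
  -- alternating sums does not vanish.
  two-cherries : ∀ cb ab cc′ ac′ ca′ aa′ c′b′ a′b′ →
    differ cb ab * differ c′b′ a′b′ ≤
    + 2 * (∣alt∣ cb ab cc′ ac′ + (∣alt∣ cb ab ca′ aa′ + ∣alt∣ c′b′ a′b′ cc′ ca′))
  two-cherries = from-yes (∀Sign? λ cb → ∀Sign? λ ab → ∀Sign? λ cc′ → ∀Sign? λ ac′ →
    ∀Sign? λ ca′ → ∀Sign? λ aa′ → ∀Sign? λ c′b′ → ∀Sign? λ a′b′ →
    differ cb ab * differ c′b′ a′b′ ℤ.≤?
    + 2 * (∣alt∣ cb ab cc′ ac′ + (∣alt∣ cb ab ca′ aa′ + ∣alt∣ c′b′ a′b′ cc′ ca′)))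

  -- A path p q r whose end edges differ in colour contains a bichromatic path
  -- of two edges.
  two-paths : ∀ p q r p′ q′ r′ →
    differ p r * differ p′ r′ ≤
    (differ p q * differ p′ q′ + differ p q * differ q′ r′) + (differ q r * differ p′ q′ + differ q r * differ q′ r′)
  two-paths = from-yes (∀Sign? λ p → ∀Sign? λ q → ∀Sign? λ r → ∀Sign? λ p′ → ∀Sign? λ q′ → ∀Sign? λ r′ →
    differ p r * differ p′ r′ ℤ.≤?
    (differ p q * differ p′ q′ + differ p q * differ q′ r′) + (differ q r * differ p′ q′ + differ q r * differ q′ r′))

  -- If j of the three pairs differ, the right-hand side is 2(3 - 2j) + 2j(j - 1), which is 6, 2, 2,
  -- 6 for j = 0, 1, 2, 3.
  three-products : ∀ p q r p′ q′ r′ →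
    + 2 ≤ + 2 * (⟪ p ⟫ * ⟪ p′ ⟫ + (⟪ q ⟫ * ⟪ q′ ⟫ + ⟪ r ⟫ * ⟪ r′ ⟫))
      + (differ p p′ * differ q q′ + (differ p p′ * differ r r′ + differ q q′ * differ r r′))
  three-products = from-yes (∀Sign? λ p → ∀Sign? λ q → ∀Sign? λ r → ∀Sign? λ p′ → ∀Sign? λ q′ → ∀Sign? λ r′ →
    + 2 ℤ.≤? + 2 * (⟪ p ⟫ * ⟪ p′ ⟫ + (⟪ q ⟫ * ⟪ q′ ⟫ + ⟪ r ⟫ * ⟪ r′ ⟫))
      + (differ p p′ * differ q q′ + (differ p p′ * differ r r′ + differ q q′ * differ r r′)))

  -- Quadruples with repeated vertices.

  coincidences : (u v z w : Fin n) → ℤ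
  coincidences u v z w = δ v u + (δ z u + (δ w u + (δ z v + (δ w v + δ w z))))

  -- Each of the six possible equalities leaves three free indices.
  Σ-coincidences : ∀ n → Σ₂ {n} (λ u v → Σ₂ (coincidences u v)) ≡ + 6 * (+ n * (+ n * + n))
  Σ-coincidences n = begin
    Σ₂ (λ u v → Σ₂ (coincidences u v))
      ≡⟨ ∑-cong (λ u → trans (∑-cong (λ v → trans (∑-cong (λ z → sum-w u v z)) (sum-z u v))) (sum-v u)) ⟩
    ∑ {n} (λ _ → m * m + m * (m + (m + (m + m * + 2))))
      ≡⟨ ∑-const n _ ⟩
    m * (m * m + m * (m + (m + (m + m * + 2))))
      ≡⟨ lem m ⟩
    + 6 * (m * (m * m)) ∎
    where
    open ≡-Reasoning
    m : ℤ
    m = + n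
    lem : ∀ m → m * (m * m + m * (m + (m + (m + m * + 2)))) ≡ + 6 * (m * (m * m))
    lem = solve-∀
    V = Fin n
    sum-w : ∀ (u v z : V) → ∑ (coincidences u v z) ≡ m * δ v u + (m * δ z u + (1ℤ + (m * δ z v + + 2)))
    sum-w u v z =
      trans (∑-+ (λ w → δ v u) _) (cong₂ _+_ (∑-const n (δ v u))
      (trans (∑-+ (λ w → δ z u) _) (cong₂ _+_ (∑-const n (δ z u))
      (trans (∑-+ (λ w → δ w u) _) (cong₂ _+_ (∑-δ₁ u)
      (trans (∑-+ (λ w → δ z v) _) (cong₂ _+_ (∑-const n (δ z v))
      (trans (∑-+ (λ w → δ w v) (λ w → δ w z)) (cong₂ _+_ (∑-δ₁ v) (∑-δ₁ z))))))))))
    sum-z : ∀ (u v : V) → ∑ (λ z → m * δ v u + (m * δ z u + (1ℤ + (m * δ z v + + 2)))) ≡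
              m * (m * δ v u) + (m + (m + (m + m * + 2)))
    sum-z u v =
      trans (∑-+ (λ z → m * δ v u) _) (cong₂ _+_ (∑-const n (m * δ v u))
      (trans (∑-+ (λ z → m * δ z u) _) (cong₂ _+_ (∑-scale-δ m u)
      (trans (∑-+ (λ z → 1ℤ) _) (cong₂ _+_ (trans (∑-const n 1ℤ) (ℤ.*-identityʳ m))
      (trans (∑-+ (λ z → m * δ z v) (λ _ → + 2)) (cong₂ _+_ (∑-scale-δ m v) (∑-const n (+ 2)))))))))
    sum-v : ∀ (u : V) → ∑ (λ v → m * (m * δ v u) + (m + (m + (m + m * + 2)))) ≡
              m * m + m * (m + (m + (m + m * + 2)))
    sum-v u = trans (∑-+ (λ v → m * (m * δ v u)) (λ _ → m + (m + (m + m * + 2))))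
      (cong₂ _+_ (trans (∑-cong (λ v → sym (ℤ.*-assoc m m (δ v u)))) (∑-scale-δ (m * m) u)) (∑-const n _))

  distinct⇒Inj : ∀ {u v z w : Fin n} → u ≢ v → u ≢ z → u ≢ w → v ≢ z → v ≢ w → z ≢ w →
                 Inj (Vec.lookup (u ∷ v ∷ z ∷ w ∷ []))
  distinct⇒Inj uv uz uw vz vw zw = lookup-injective
    ((uv All.∷ uz All.∷ uw All.∷ All.[]) AllPairs.∷ (vz All.∷ vw All.∷ All.[]) AllPairs.∷
     (zw All.∷ All.[]) AllPairs.∷ All.[] AllPairs.∷ AllPairs.[])

  -- Correlations of the colours of random edges.

  module Colours {n : ℕ} (c : Fin n → Fin n → Sign) (c-sym : ∀ x y → c x y ≡ c y x) where

    open Average n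
    private V = Fin n

    f : V → V → ℤ
    f x y = ⟪ c x y ⟫

    f-sym : ∀ x y → f x y ≡ f y x
    f-sym x y = cong ⟪_⟫ (c-sym x y)

    q : (Fin 4 → V) → ℤ
    q t = abs (alt f (t 0F) (t 1F) (t 2F) (t 3F))

    X : (Fin 4 → V) → ℤ
    X t = f (t 0F) (t 1F) * f (t 2F) (t 3F)

    q-Ext : Ext q
    q-Ext eq rewrite eq 0F | eq 1F | eq 2F | eq 3F = refl

    X-Ext : Ext X
    X-Ext eq rewrite eq 0F | eq 1F | eq 2F | eq 3F = refl

    module Uniform (12≤n : 12 ℕ.≤ n) where

      -- Twelve distinct vertices hold six disjoint edges, the configuration of `N≤3Ξ+36Q`.
      ι : Fin 12 → V
      ι i = inject≤ i 12≤n

      ι-Inj : Inj ι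
      ι-Inj i j = inject≤-injective 12≤n 12≤n i j

      first : k ℕ.≤ 12 → Fin k → V
      first k≤12 i = ι (inject≤ i k≤12)

      first-Inj : (k≤12 : k ℕ.≤ 12) → Inj (first k≤12)
      first-Inj k≤12 i j e = inject≤-injective k≤12 k≤12 i j (ι-Inj _ _ e)

      4≤12 : 4 ℕ.≤ 12
      4≤12 = s≤s (s≤s (s≤s (s≤s z≤n)))

      2≤12 : 2 ℕ.≤ 12
      2≤12 = s≤s (s≤s z≤n)

      -- Up to the factor `N`, the mean absolute alternating sum and the mean product of the colours
      -- of two disjoint edges. The sample tuple is arbitrary by `E-tuple`.
      Q Ξ : ℤ
      Q = E (λ π → q (π ∘ first 4≤12))
      Ξ = E (λ π → X (π ∘ first 4≤12))

      E-q : ∀ {t} → Inj t → E (λ π → q (π ∘ t)) ≡ Q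
      E-q inj = E-tuple q q-Ext _ _ inj (first-Inj 4≤12)

      E-X : ∀ {t} → Inj t → E (λ π → X (π ∘ t)) ≡ Ξ
      E-X inj = E-tuple X X-Ext _ _ inj (first-Inj 4≤12)

      -- `two-cherries` for the paths 0 1 2 and 3 4 5. Each of its three alternating sums runs over
      -- distinct vertices and so averages to `Q`.
      E-cherries : (t : Fin 6 → V) → Inj t →
        E (λ π → (1ℤ - f (π (t 0F)) (π (t 1F)) * f (π (t 2F)) (π (t 1F)))
               * (1ℤ - f (π (t 3F)) (π (t 4F)) * f (π (t 5F)) (π (t 4F)))) ≤ + 6 * Q
      E-cherries t inj = begin
        E (λ π → (1ℤ - f (π (t 0F)) (π (t 1F)) * f (π (t 2F)) (π (t 1F)))
               * (1ℤ - f (π (t 3F)) (π (t 4F)) * f (π (t 5F)) (π (t 4F))))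
          ≤⟨ E-mono (λ π _ → pointwise π) ⟩
        E (λ π → + 2 * (q (π ∘ t ∘ r₁) + (q (π ∘ t ∘ r₂) + q (π ∘ t ∘ r₃))))
          ≡⟨ E-* (+ 2) (λ π → q (π ∘ t ∘ r₁) + (q (π ∘ t ∘ r₂) + q (π ∘ t ∘ r₃))) ⟩
        + 2 * E (λ π → q (π ∘ t ∘ r₁) + (q (π ∘ t ∘ r₂) + q (π ∘ t ∘ r₃)))
          ≡⟨ cong (+ 2 *_) (trans (E-+ (λ π → q (π ∘ t ∘ r₁)) (λ π → q (π ∘ t ∘ r₂) + q (π ∘ t ∘ r₃)))
               (cong₂ _+_ (E-q (Inj-∘ inj (from-yes (inj? r₁))))
                  (trans (E-+ (λ π → q (π ∘ t ∘ r₂)) (λ π → q (π ∘ t ∘ r₃)))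
                    (cong₂ _+_ (E-q (Inj-∘ inj (from-yes (inj? r₂)))) (E-q (Inj-∘ inj (from-yes (inj? r₃)))))))) ⟩
        + 2 * (Q + (Q + Q))
          ≡⟨ lem Q ⟩
        + 6 * Q ∎
        where
        open ℤ.≤-Reasoning
        r₁ r₂ r₃ : Fin 4 → Fin 6
        r₁ = Vec.lookup (0F ∷ 2F ∷ 1F ∷ 3F ∷ [])
        r₂ = Vec.lookup (0F ∷ 2F ∷ 1F ∷ 5F ∷ [])
        r₃ = Vec.lookup (3F ∷ 5F ∷ 4F ∷ 0F ∷ [])
        lem : ∀ x → + 2 * (x + (x + x)) ≡ + 6 * x
        lem = solve-∀
        pointwise : ∀ π → (1ℤ - f (π (t 0F)) (π (t 1F)) * f (π (t 2F)) (π (t 1F)))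
               * (1ℤ - f (π (t 3F)) (π (t 4F)) * f (π (t 5F)) (π (t 4F)))
               ≤ + 2 * (q (π ∘ t ∘ r₁) + (q (π ∘ t ∘ r₂) + q (π ∘ t ∘ r₃)))
        -- The third alternating sum reads the edges 03 and 05 from their other ends.
        pointwise π = subst₂ (λ x y → (1ℤ - C 0F 1F * C 2F 1F) * (1ℤ - C 3F 4F * C 5F 4F)
            ≤ + 2 * (q (π ∘ t ∘ r₁) + (q (π ∘ t ∘ r₂) + abs (C 3F 4F - C 5F 4F - x + y))))
            (f-sym (π (t 0F)) (π (t 3F))) (f-sym (π (t 0F)) (π (t 5F)))
            (two-cherries (S 0F 1F) (S 2F 1F) (S 0F 3F) (S 2F 3F) (S 0F 5F) (S 2F 5F) (S 3F 4F) (S 5F 4F))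
          where
          S : Fin 6 → Fin 6 → Sign
          S i j = c (π (t i)) (π (t j))
          C : Fin 6 → Fin 6 → ℤ
          C i j = ⟪ S i j ⟫

      -- Joining the edges 01 and 23 by 12, and 45 and 67 by 56, gives two paths of three edges.
      -- `two-paths` then leaves four pairs of cherries, `r₁` to `r₄`, each costing 6 `Q`.
      E-edges : (t : Fin 8 → V) → Inj t →
        E (λ π → (1ℤ - f (π (t 0F)) (π (t 1F)) * f (π (t 2F)) (π (t 3F)))
               * (1ℤ - f (π (t 4F)) (π (t 5F)) * f (π (t 6F)) (π (t 7F)))) ≤ + 24 * Q
      E-edges t inj = begin
        E (λ π → (1ℤ - f (π (t 0F)) (π (t 1F)) * f (π (t 2F)) (π (t 3F)))
               * (1ℤ - f (π (t 4F)) (π (t 5F)) * f (π (t 6F)) (π (t 7F))))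
          ≤⟨ E-mono (λ π _ → pointwise π) ⟩
        E (λ π → (Y r₁ π + Y r₂ π) + (Y r₃ π + Y r₄ π))
          ≡⟨ trans (E-+ (λ π → Y r₁ π + Y r₂ π) (λ π → Y r₃ π + Y r₄ π)) (cong₂ _+_ (E-+ (Y r₁) (Y r₂)) (E-+ (Y r₃) (Y r₄))) ⟩
        (E (Y r₁) + E (Y r₂)) + (E (Y r₃) + E (Y r₄))
          ≤⟨ ℤ.+-mono-≤ (ℤ.+-mono-≤ (Y≤ r₁ (from-yes (inj? r₁))) (Y≤ r₂ (from-yes (inj? r₂))))
                        (ℤ.+-mono-≤ (Y≤ r₃ (from-yes (inj? r₃))) (Y≤ r₄ (from-yes (inj? r₄)))) ⟩
        (+ 6 * Q + + 6 * Q) + (+ 6 * Q + + 6 * Q)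
          ≡⟨ lem Q ⟩
        + 24 * Q ∎
        where
        open ℤ.≤-Reasoning
        lem : ∀ x → (+ 6 * x + + 6 * x) + (+ 6 * x + + 6 * x) ≡ + 24 * x
        lem = solve-∀
        Y : (Fin 6 → Fin 8) → (V → V) → ℤ
        Y r π = (1ℤ - f (π (t (r 0F))) (π (t (r 1F))) * f (π (t (r 2F))) (π (t (r 1F))))
              * (1ℤ - f (π (t (r 3F))) (π (t (r 4F))) * f (π (t (r 5F))) (π (t (r 4F))))
        Y≤ : ∀ r → Inj r → E (Y r) ≤ + 6 * Q
        Y≤ r r-inj = E-cherries (t ∘ r) (Inj-∘ inj r-inj)
        r₁ r₂ r₃ r₄ : Fin 6 → Fin 8
        r₁ = Vec.lookup (0F ∷ 1F ∷ 2F ∷ 4F ∷ 5F ∷ 6F ∷ [])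
        r₂ = Vec.lookup (0F ∷ 1F ∷ 2F ∷ 5F ∷ 6F ∷ 7F ∷ [])
        r₃ = Vec.lookup (1F ∷ 2F ∷ 3F ∷ 4F ∷ 5F ∷ 6F ∷ [])
        r₄ = Vec.lookup (1F ∷ 2F ∷ 3F ∷ 5F ∷ 6F ∷ 7F ∷ [])
        pointwise : ∀ π → (1ℤ - f (π (t 0F)) (π (t 1F)) * f (π (t 2F)) (π (t 3F)))
               * (1ℤ - f (π (t 4F)) (π (t 5F)) * f (π (t 6F)) (π (t 7F)))
               ≤ (Y r₁ π + Y r₂ π) + (Y r₃ π + Y r₄ π)
        pointwise π rewrite c-sym (π (t 2F)) (π (t 1F)) | c-sym (π (t 3F)) (π (t 2F))
          | c-sym (π (t 6F)) (π (t 5F)) | c-sym (π (t 7F)) (π (t 6F)) =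
          two-paths (S 0F 1F) (S 1F 2F) (S 2F 3F) (S 4F 5F) (S 5F 6F) (S 6F 7F)
          where
          S : Fin 8 → Fin 8 → Sign
          S i j = c (π (t i)) (π (t j))

      -- The average of `three-products` over three pairs of disjoint edges, halved. If alternating
      -- sums are mostly zero, disjoint edges are thus positively correlated.
      N≤3Ξ+36Q : N ≤ + 3 * Ξ + + 36 * Q
      N≤3Ξ+36Q = ℤ.*-cancelˡ-≤-pos _ _ (+ 2) (begin
        + 2 * N
          ≡⟨ sym (E-const (+ 2)) ⟩
        E (λ _ → + 2)
          ≤⟨ E-mono (λ π _ → three-products (S π 0F 1F) (S π 4F 5F) (S π 8F 9F) (S π 2F 3F) (S π 6F 7F) (S π 10F 11F)) ⟩
        E (λ π → + 2 * (Xr b₁ π + (Xr b₂ π + Xr b₃ π)) + (Y b₁ b₂ π + (Y b₁ b₃ π + Y b₂ b₃ π)))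
          ≡⟨ trans (E-+ (λ π → + 2 * (Xr b₁ π + (Xr b₂ π + Xr b₃ π))) (λ π → Y b₁ b₂ π + (Y b₁ b₃ π + Y b₂ b₃ π)))
              (cong₂ _+_ (trans (E-* (+ 2) (λ π → Xr b₁ π + (Xr b₂ π + Xr b₃ π)))
                  (cong (+ 2 *_) (trans (E-+ (Xr b₁) (λ π → Xr b₂ π + Xr b₃ π)) (cong₂ _+_ (EX b₁ (from-yes (inj? b₁)))
                     (trans (E-+ (Xr b₂) (Xr b₃)) (cong₂ _+_ (EX b₂ (from-yes (inj? b₂))) (EX b₃ (from-yes (inj? b₃)))))))))
                (trans (E-+ (Y b₁ b₂) (λ π → Y b₁ b₃ π + Y b₂ b₃ π)) (cong (λ x → E (Y b₁ b₂) + x) (E-+ (Y b₁ b₃) (Y b₂ b₃))))) ⟩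
        + 2 * (Ξ + (Ξ + Ξ)) + (E (Y b₁ b₂) + (E (Y b₁ b₃) + E (Y b₂ b₃)))
          ≤⟨ ℤ.+-monoʳ-≤ (+ 2 * (Ξ + (Ξ + Ξ))) (ℤ.+-mono-≤ (Y≤ r₁₂ (from-yes (inj? r₁₂)))
               (ℤ.+-mono-≤ (Y≤ r₁₃ (from-yes (inj? r₁₃))) (Y≤ r₂₃ (from-yes (inj? r₂₃))))) ⟩
        + 2 * (Ξ + (Ξ + Ξ)) + (+ 24 * Q + (+ 24 * Q + + 24 * Q))
          ≡⟨ lem Ξ Q ⟩
        + 2 * (+ 3 * Ξ + + 36 * Q) ∎)
        where
        open ℤ.≤-Reasoning
        lem : ∀ x y → + 2 * (x + (x + x)) + (+ 24 * y + (+ 24 * y + + 24 * y)) ≡ + 2 * (+ 3 * x + + 36 * y)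
        lem = solve-∀
        pattern 10F = suc (suc (suc (suc (suc (suc (suc (suc (suc (suc zero)))))))))
        pattern 11F = suc (suc (suc (suc (suc (suc (suc (suc (suc (suc (suc zero))))))))))
        S : (V → V) → Fin 12 → Fin 12 → Sign
        S π i j = c (π (ι i)) (π (ι j))
        b₁ b₂ b₃ : Fin 4 → Fin 12
        b₁ = Vec.lookup (0F ∷ 1F ∷ 2F ∷ 3F ∷ [])
        b₂ = Vec.lookup (4F ∷ 5F ∷ 6F ∷ 7F ∷ [])
        b₃ = Vec.lookup (8F ∷ 9F ∷ 10F ∷ 11F ∷ [])
        r₁₂ r₁₃ r₂₃ : Fin 8 → Fin 12
        r₁₂ = Vec.lookup (0F ∷ 1F ∷ 2F ∷ 3F ∷ 4F ∷ 5F ∷ 6F ∷ 7F ∷ [])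
        r₁₃ = Vec.lookup (0F ∷ 1F ∷ 2F ∷ 3F ∷ 8F ∷ 9F ∷ 10F ∷ 11F ∷ [])
        r₂₃ = Vec.lookup (4F ∷ 5F ∷ 6F ∷ 7F ∷ 8F ∷ 9F ∷ 10F ∷ 11F ∷ [])
        Xr : (Fin 4 → Fin 12) → (V → V) → ℤ
        Xr b π = X (π ∘ ι ∘ b)
        EX : ∀ b → Inj b → E (Xr b) ≡ Ξ
        EX b b-inj = E-X (Inj-∘ ι-Inj b-inj)
        Y : (Fin 4 → Fin 12) → (Fin 4 → Fin 12) → (V → V) → ℤ
        Y b b′ π = (1ℤ - Xr b π) * (1ℤ - Xr b′ π)
        Y≤ : ∀ r → Inj r → E (λ π → (1ℤ - X (π ∘ ι ∘ r ∘ Vec.lookup (0F ∷ 1F ∷ 2F ∷ 3F ∷ [])))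
                                  * (1ℤ - X (π ∘ ι ∘ r ∘ Vec.lookup (4F ∷ 5F ∷ 6F ∷ 7F ∷ [])))) ≤ + 24 * Q
        Y≤ r r-inj = E-edges (ι ∘ r) (Inj-∘ ι-Inj r-inj)

      private
        m : ℤ
        m = + n

      -- The diagonal is included, although its colours are arbitrary; `S-bound` accounts for it.
      S : ℤ
      S = Σ₂ f

      abs-X≡1 : ∀ t → abs (X t) ≡ 1ℤ
      abs-X≡1 t = trans (abs-* (f (t 0F) (t 1F)) (f (t 2F) (t 3F))) (cong₂ _*_ (abs-⟪⟫ (c (t 0F) (t 1F))) (abs-⟪⟫ (c (t 2F) (t 3F))))

      abs-E-X : ∀ t → abs (E (λ π → X (π ∘ t))) ≤ N
      abs-E-X t = ℤ.≤-trans (abs-E _) (ℤ.≤-reflexive (E-cong (λ π → abs-X≡1 (π ∘ t))))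

      E-alt : ∀ {u v z w} → u ≢ v → u ≢ z → u ≢ w → v ≢ z → v ≢ w → z ≢ w →
              E (λ π → abs (alt f (π u) (π v) (π z) (π w))) ≡ Q
      E-alt uv uz uw vz vw zw = E-q (distinct⇒Inj uv uz uw vz vw zw)

      Ξ₄ : V → V → V → V → ℤ
      Ξ₄ u v z w = E (λ π → f (π u) (π v) * f (π z) (π w))

      -- Both Ξ and Ξ₄ lie between − N and N, hence the factor 2.
      Ξ₄-lower : ∀ u v z w → Ξ - + 2 * N * coincidences u v z w ≤ Ξ₄ u v z w
      Ξ₄-lower u v z w = cases (v ≟ u) (z ≟ u) (w ≟ u) (z ≟ v) (w ≟ v) (w ≟ z)
        where
        0≤N : 0ℤ ≤ N
        0≤N = ℤ.≤-trans 0≤+n 1≤N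
        e : ℤ
        e = coincidences u v z w
        0≤vu = ⟦⟧-nonneg (v ≟ u)
        0≤zu = ⟦⟧-nonneg (z ≟ u)
        0≤wu = ⟦⟧-nonneg (w ≟ u)
        0≤zv = ⟦⟧-nonneg (z ≟ v)
        0≤wv = ⟦⟧-nonneg (w ≟ v)
        0≤wz = ⟦⟧-nonneg (w ≟ z)
        0≤e₁ : 0ℤ ≤ δ w v + δ w z
        0≤e₁ = 0≤+ 0≤wv 0≤wz
        0≤e₂ : 0ℤ ≤ δ z v + (δ w v + δ w z)
        0≤e₂ = 0≤+ 0≤zv 0≤e₁
        0≤e₃ : 0ℤ ≤ δ w u + (δ z v + (δ w v + δ w z))
        0≤e₃ = 0≤+ 0≤wu 0≤e₂
        0≤e₄ : 0ℤ ≤ δ z u + (δ w u + (δ z v + (δ w v + δ w z)))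
        0≤e₄ = 0≤+ 0≤zu 0≤e₃
        equal : ∀ {i j : V} → i ≡ j → δ i j ≤ e → Ξ - + 2 * N * e ≤ Ξ₄ u v z w
        equal {i} {j} i≡j δ≤e = ≤-by (lem Ξ N e (Ξ₄ u v z w)) (0≤+ (0≤+
          (0≤-of (ℤ.≤-trans (≤-abs Ξ) (abs-E-X (first 4≤12))))
          (0≤-of (ℤ.≤-trans (neg≤-abs (Ξ₄ u v z w)) (abs-E-X (Vec.lookup (u ∷ v ∷ z ∷ w ∷ []))))))
          (0≤* {+ 2 * N} {e - 1ℤ} (0≤* {+ 2} 0≤+n 0≤N) (0≤-of (subst (_≤ e) (⟦⟧-yes (i ≟ j) i≡j) δ≤e))))
          where
          lem : ∀ x n e y → y - (x - + 2 * n * e) ≡ (n - x) + (n - - y) + + 2 * n * (e - 1ℤ)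
          lem = solve-∀
        cases : Dec (v ≡ u) → Dec (z ≡ u) → Dec (w ≡ u) → Dec (z ≡ v) → Dec (w ≡ v) → Dec (w ≡ z) →
                Ξ - + 2 * N * e ≤ Ξ₄ u v z w
        cases (yes p) _ _ _ _ _ = equal p (≤+ˡ 0≤e₄)
        cases _ (yes p) _ _ _ _ = equal p (≤+ʳ 0≤vu (≤+ˡ 0≤e₃))
        cases _ _ (yes p) _ _ _ = equal p (≤+ʳ 0≤vu (≤+ʳ 0≤zu (≤+ˡ 0≤e₂)))
        cases _ _ _ (yes p) _ _ = equal p (≤+ʳ 0≤vu (≤+ʳ 0≤zu (≤+ʳ 0≤wu (≤+ˡ 0≤e₁))))
        cases _ _ _ _ (yes p) _ = equal p (≤+ʳ 0≤vu (≤+ʳ 0≤zu (≤+ʳ 0≤wu (≤+ʳ 0≤zv (≤+ˡ 0≤wz)))))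
        cases _ _ _ _ _ (yes p) = equal p (≤+ʳ 0≤vu (≤+ʳ 0≤zu (≤+ʳ 0≤wu (≤+ʳ 0≤zv (≤+ʳ 0≤wv ℤ.≤-refl)))))
        cases (no a) (no b) (no c) (no d) (no e′) (no g) = ≤-by
          (trans (cong (λ x → x - (Ξ - + 2 * N * e))
            (E-X (distinct⇒Inj (a ∘ sym) (b ∘ sym) (c ∘ sym) (d ∘ sym) (e′ ∘ sym) (g ∘ sym))))
            (lem Ξ (+ 2 * N * e)))
          (0≤* {+ 2 * N} {e} (0≤* {+ 2} 0≤+n 0≤N) (0≤+ 0≤vu 0≤e₄))
          where
          lem : ∀ x y → x - (x - y) ≡ y
          lem = solve-∀

      -- For each bijection the sum over all quadruples factors as `S * S`; then the order of
      -- summation is exchanged.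
      ΣΞ₄ : Σ₂ (λ u v → Σ₂ (Ξ₄ u v)) ≡ S * S * N
      ΣΞ₄ = begin
        Σ₂ (λ u v → Σ₂ (Ξ₄ u v))
          ≡⟨ Σ₂-cong (λ u v → sym (E-Σ₂ (λ z w π → f (π u) (π v) * f (π z) (π w)))) ⟩
        Σ₂ (λ u v → E (λ π → Σ₂ (λ z w → f (π u) (π v) * f (π z) (π w))))
          ≡⟨ sym (E-Σ₂ (λ u v π → Σ₂ (λ z w → f (π u) (π v) * f (π z) (π w)))) ⟩
        E (λ π → Σ₂ (λ u v → Σ₂ (λ z w → f (π u) (π v) * f (π z) (π w))))
          ≡⟨ E-congᵢ (λ π inj → trans
               (Σ₂-cong (λ u v → trans (Σ₂-scale (f (π u) (π v)) (λ z w → f (π z) (π w)))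
                 (trans (cong (f (π u) (π v) *_) (Σ₂-Inj π inj f)) (ℤ.*-comm (f (π u) (π v)) S))))
               (trans (Σ₂-scale S (λ u v → f (π u) (π v))) (cong (S *_) (Σ₂-Inj π inj f)))) ⟩
        E (λ _ → S * S)
          ≡⟨ E-const (S * S) ⟩
        S * S * N ∎
        where open ≡-Reasoning

      -- `Ξ₄-lower` summed over all quadruples: an upper bound for the correlation `Ξ` in terms of
      -- the total colour, with an error of order n³ from repeated vertices.
      Ξ-bound : m * (m * (m * (m * Ξ))) - + 2 * N * (+ 6 * (m * (m * m))) ≤ S * S * N
      Ξ-bound = begin
        m * (m * (m * (m * Ξ))) - + 2 * N * (+ 6 * (m * (m * m)))
          ≡⟨ cong₂ _-_ (sym (trans (Σ₂-cong (λ u v → Σ₂-const n Ξ)) (Σ₂-const n _)))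
               (sym (trans (Σ₂-cong (λ u v → Σ₂-scale (+ 2 * N) (coincidences u v)))
                 (trans (Σ₂-scale (+ 2 * N) (λ u v → Σ₂ (coincidences u v))) (cong (+ 2 * N *_) (Σ-coincidences n))))) ⟩
        Σ₂ (λ u v → Σ₂ (λ z w → Ξ)) - Σ₂ (λ u v → Σ₂ (λ z w → + 2 * N * coincidences u v z w))
          ≡⟨ trans (sym (Σ₂-- _ _)) (Σ₂-cong (λ u v → sym (Σ₂-- _ _))) ⟩
        Σ₂ (λ u v → Σ₂ (λ z w → Ξ - + 2 * N * coincidences u v z w))
          ≤⟨ Σ₂-mono (λ u v → Σ₂-mono (Ξ₄-lower u v)) ⟩
        Σ₂ (λ u v → Σ₂ (Ξ₄ u v))
          ≡⟨ ΣΞ₄ ⟩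
        S * S * N ∎
        where open ℤ.≤-Reasoning

      φ : (Fin 2 → V) → ℤ
      φ t = f (t 0F) (t 1F)

      φ-Ext : Ext φ
      φ-Ext eq rewrite eq 0F | eq 1F = refl

      Φ : ℤ
      Φ = E (λ π → φ (π ∘ first 2≤12))

      E-f : ∀ {u v} → u ≢ v → E (λ π → f (π u) (π v)) ≡ Φ
      E-f {u} {v} u≢v = E-tuple φ φ-Ext (Vec.lookup (u ∷ v ∷ [])) _
        (lookup-injective ((u≢v All.∷ All.[]) AllPairs.∷ All.[] AllPairs.∷ AllPairs.[])) (first-Inj 2≤12)

      abs-E-f : ∀ u v → abs (E (λ π → f (π u) (π v))) ≤ abs Φ + N * δ v u
      abs-E-f u v with v ≟ u
      ... | yes _ = ≤+ʳ {abs Φ} 0≤+n (ℤ.≤-trans (abs-E _) (ℤ.≤-reflexive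
                      (trans (E-cong (λ π → abs-⟪⟫ (c (π u) (π v)))) (sym (ℤ.*-identityʳ N)))))
      ... | no v≢u = ℤ.≤-reflexive (trans (cong abs (E-f (v≢u ∘ sym)))
                      (sym (trans (cong (λ x → abs Φ + x) (ℤ.*-zeroʳ N)) (ℤ.+-identityʳ (abs Φ)))))

      ΣE-f : Σ₂ (λ u v → E (λ π → f (π u) (π v))) ≡ S * N
      ΣE-f = trans (sym (E-Σ₂ (λ u v π → f (π u) (π v)))) (trans (E-congᵢ (λ π inj → Σ₂-Inj π inj f)) (E-const S))

      -- Off the diagonal every entry averages to `Φ`. The last term pays for the n diagonal
      -- entries.
      S-bound : abs S * N ≤ m * (m * abs Φ) + m * N
      S-bound = begin
        abs S * N
          ≡⟨ cong (abs S *_) (sym (ℤ.0≤i⇒+∣i∣≡i (ℤ.≤-trans 0≤+n 1≤N))) ⟩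
        abs S * abs N
          ≡⟨ trans (sym (abs-* S N)) (cong abs (sym ΣE-f)) ⟩
        abs (Σ₂ (λ u v → E (λ π → f (π u) (π v))))
          ≤⟨ ℤ.≤-trans (abs-∑ _) (∑-mono (λ u → abs-∑ _)) ⟩
        Σ₂ (λ u v → abs (E (λ π → f (π u) (π v))))
          ≤⟨ Σ₂-mono abs-E-f ⟩
        Σ₂ (λ u v → abs Φ + N * δ v u)
          ≡⟨ trans (Σ₂-+ (λ _ _ → abs Φ) (λ u v → N * δ v u))
               (cong₂ _+_ (Σ₂-const n (abs Φ)) (trans (∑-cong (λ u → ∑-scale-δ N u)) (∑-const n N))) ⟩
        m * (m * abs Φ) + m * N ∎
        where open ℤ.≤-Reasoning

  -- Greedy construction of the involution.

  module Greedy {n : ℕ} (F : Graph n) where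
    open Graph F using (Adj; adj?; degree) renaming (sym to Adj-sym; irrefl to Adj-irrefl)
    open import Data.List.Membership.DecPropositional (_≟_ {n}) using (_∈?_)

    private V = Fin n

    a : V → V → ℤ
    a u v = ⟦ adj? u v ⟧

    a-sym : ∀ u v → a u v ≡ a v u
    a-sym u v = ⟦⟧-⇔ (adj? u v) (adj? v u) Adj-sym Adj-sym

    Adj⇒≢ : ∀ {u v} → Adj u v → u ≢ v
    Adj⇒≢ uv u≡v = Adj-irrefl u≡v uv

    ∃∉ : (L : List V) → length L ℕ.< n → ∃ λ v → v ∉ L
    ∃∉ L L<n with any? (λ v → ¬? (v ∈? L))
    ... | yes p = p
    ... | no ¬p = contradiction (injective⇒≤ {f = λ v → index (all∈ v)} injective) (ℕ.<⇒≱ L<n)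
      where
      all∈ : ∀ v → v ∈ L
      all∈ v = decidable-stable (v ∈? L) (λ v∉L → ¬p (v , v∉L))
      injective : ∀ {u v} → index (all∈ u) ≡ index (all∈ v) → u ≡ v
      injective {u} {v} e = trans (lookup-index (all∈ u))
        (trans (cong (lookup L) e) (sym (lookup-index (all∈ v))))

    ∃-non-neighbour : ∀ x (L : List V) → degree x ℕ.+ length L ℕ.< n → ∃ λ v → ¬ Adj x v × v ∉ L
    ∃-non-neighbour x L d+L<n
      with v , v∉ ← ∃∉ (filter (adj? x) (allFin n) ++ L) (subst (ℕ._< n) (sym (length-++ (filter (adj? x) (allFin n)))) d+L<n)
      = v , (λ xv → v∉ (∈-++⁺ˡ (∈-filter⁺ (adj? x) (∈-allFin v) xv))) , (v∉ ∘ ∈-++⁺ʳ (filter (adj? x) (allFin n)))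

    ∉⇒≢ : ∀ {x y : V} {L} → x ∈ L → y ∉ L → x ≢ y
    ∉⇒≢ x∈L y∉L refl = y∉L x∈L

    record Witness (τ : V → V) (used : List V) (x : V) : Set where
      field
        z w   : V
        z≢w   : z ≢ w
        z≢x   : z ≢ x
        w≢x   : w ≢ x
        τx≢x  : τ x ≢ x
        τz    : τ z ≡ z
        τw    : τ w ≡ w
        z∈    : z ∈ used
        w∈    : w ∈ used
        alt≢0 : alt a x (τ x) z w ≢ 0ℤ

    -- An involution τ moving only used vertices, at least k of which (marked by
    -- χ) differ from their partner in a way seen by two fixed points of τ.
    record Switches (Protected : V → Set) (k : ℕ) (used : List V) : Set where
      field
        τ       : V → V
        τ-inv   : ∀ u → τ (τ u) ≡ u
        unused  : ∀ {x} → x ∉ used → τ x ≡ x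
        fixed   : ∀ {x} → Protected x → τ x ≡ x
        χ       : V → ℤ
        χ-sum   : + k ≤ ∑ χ
        χ-cases : ∀ x → χ x ≡ 0ℤ ⊎ (χ x ≡ 1ℤ × Witness τ used x)

    empty : ∀ P used → Switches P 0 used
    empty P used = record
      { τ = id ; τ-inv = λ _ → refl ; unused = λ _ → refl ; fixed = λ _ → refl
      ; χ = λ _ → 0ℤ ; χ-sum = ℤ.≤-reflexive (sym (∑-0 n)) ; χ-cases = λ _ → inj₁ refl }

    extend : ∀ {P k used} (s : Switches P k used) {u v z w} → let open Switches s in
      u ∉ used → v ∉ used → ¬ P u → ¬ P v → u ≢ v → z ≢ w → z ≢ u → z ≢ v → w ≢ u → w ≢ v →
      τ z ≡ z → τ w ≡ w → alt a u v z w ≢ 0ℤ → Switches P (suc k) (u ∷ v ∷ z ∷ w ∷ used)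
    extend {P} {k} {used} s {u} {v} {z} {w} u∉ v∉ ¬Pu ¬Pv u≢v z≢w z≢u z≢v w≢u w≢v τz τw alt≢0 = record
      { τ       = τ′
      ; τ-inv   = τ′-inv
      ; unused  = λ x∉ → trans (τ′-other (x∉ ∘ here) (x∉ ∘ there ∘ here))
                               (unused (x∉ ∘ there ∘ there ∘ there ∘ there))
      ; fixed   = λ {x} Px → trans (τ′-other (λ { refl → ¬Pu Px }) (λ { refl → ¬Pv Px })) (fixed Px)
      -- Only u is marked, not its partner v, so each pair counts once.
      ; χ       = λ x → χ x + δ x u
      ; χ-sum   = subst (+ suc k ≤_) (sym (trans (∑-+ χ (λ x → δ x u)) (cong (λ y → ∑ χ + y) (∑-δ₁ u))))
                    (subst (_≤ ∑ χ + 1ℤ) (cong +_ (ℕ.+-comm k 1)) (ℤ.+-monoˡ-≤ 1ℤ χ-sum))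
      ; χ-cases = χ′-cases
      }
      where
      open Switches s
      τ′ : V → V
      τ′ x = transpose u v (τ x)

      τ′-u : τ′ u ≡ v
      τ′-u = trans (cong (transpose u v) (unused u∉)) (transpose-l u v)

      τ′-v : τ′ v ≡ u
      τ′-v = trans (cong (transpose u v) (unused v∉)) (transpose-r u v)

      τ-avoids : ∀ {x y} → x ≢ y → y ∉ used → τ x ≢ y
      τ-avoids {x} x≢y y∉ τx≡y = x≢y (trans (sym (τ-inv x)) (trans (cong τ τx≡y) (unused y∉)))

      τ′-other : ∀ {x} → x ≢ u → x ≢ v → τ′ x ≡ τ x
      τ′-other x≢u x≢v = transpose-fix (τ-avoids x≢u u∉) (τ-avoids x≢v v∉)

      τ′-inv : ∀ x → τ′ (τ′ x) ≡ x
      τ′-inv x with x ≟ u | x ≟ v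
      ... | yes refl | _        = trans (cong τ′ τ′-u) τ′-v
      ... | no _     | yes refl = trans (cong τ′ τ′-v) τ′-u
      ... | no x≢u   | no x≢v   = trans (cong τ′ (τ′-other x≢u x≢v))
        (trans (τ′-other (τ-avoids x≢u u∉) (τ-avoids x≢v v∉)) (τ-inv x))

      χ′-cases : ∀ x → χ x + δ x u ≡ 0ℤ ⊎ (χ x + δ x u ≡ 1ℤ × Witness τ′ (u ∷ v ∷ z ∷ w ∷ used) x)
      χ′-cases x with x ≟ u | χ-cases x
      ... | yes refl | inj₂ (_ , W) = contradiction (unused u∉) (Witness.τx≢x W)
      ... | yes refl | inj₁ χx = inj₂ (cong (_+ 1ℤ) χx , record
        { z = z ; w = w ; z≢w = z≢w ; z≢x = z≢u ; w≢x = w≢u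
        ; τx≢x = λ e → u≢v (trans (sym e) τ′-u)
        ; τz = trans (τ′-other z≢u z≢v) τz ; τw = trans (τ′-other w≢u w≢v) τw
        ; z∈ = there (there (here refl)) ; w∈ = there (there (there (here refl)))
        ; alt≢0 = subst (λ y → alt a u y z w ≢ 0ℤ) (sym τ′-u) alt≢0 })
      ... | no _ | inj₁ χx = inj₁ (cong (_+ 0ℤ) χx)
      ... | no x≢u | inj₂ (χx , W) = inj₂ (cong (_+ 0ℤ) χx , record
        { z = W.z ; w = W.w ; z≢w = W.z≢w ; z≢x = W.z≢x ; w≢x = W.w≢x
        ; τx≢x = W.τx≢x ∘ trans (sym τ′x)
        ; τz = trans (τ′-used W.z∈) W.τz ; τw = trans (τ′-used W.w∈) W.τw
        ; z∈ = there (there (there (there W.z∈))) ; w∈ = there (there (there (there W.w∈)))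
        ; alt≢0 = subst (λ y → alt a x y W.z W.w ≢ 0ℤ) (sym τ′x) W.alt≢0 })
        where
        module W = Witness W
        τ′-used : ∀ {y} → y ∈ used → τ′ y ≡ τ y
        τ′-used y∈ = τ′-other (∉⇒≢ y∈ u∉) (∉⇒≢ y∈ v∉)
        τ′x : τ′ x ≡ τ x
        τ′x = τ′-other x≢u (λ { refl → W.τx≢x (unused v∉) })

    Candidate : List V → V → V → V → V → Set
    Candidate L u v z w = (u ∉ L × v ∉ L × z ∉ L × w ∉ L)
      × (u ≢ v × z ≢ w × z ≢ u × z ≢ v × w ≢ u × w ≢ v) × alt a u v z w ≢ 0ℤ

    candidate? : ∀ L u v z w → Dec (Candidate L u v z w)
    candidate? L u v z w = (∉? u ×-dec ∉? v ×-dec ∉? z ×-dec ∉? w)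
      ×-dec ((u ≢? v) ×-dec (z ≢? w) ×-dec (z ≢? u) ×-dec (z ≢? v) ×-dec (w ≢? u) ×-dec (w ≢? v))
      ×-dec ¬? (alt a u v z w ℤ.≟ 0ℤ)
      where
      ∉? : ∀ x → Dec (x ∉ L)
      ∉? x = ¬? (x ∈? L)
      _≢?_ : (x y : V) → Dec (x ≢ y)
      x ≢? y = ¬? (x ≟ y)

    Stuck : List V → Set
    Stuck L = ∀ u v z w → ¬ Candidate L u v z w

    -- Each round consumes four fresh vertices. Once a round fails, its list is kept, so a stuck
    -- list is never longer than 4k.
    greedy : ∀ k → (∃ λ used → length used ℕ.≤ 4 ℕ.* k × Switches (λ _ → ⊥) k used)
                 ⊎ (∃ λ used → length used ℕ.≤ 4 ℕ.* k × Stuck used)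
    greedy zero = inj₁ ([] , z≤n , empty _ [])
    greedy (suc k) with greedy k
    ... | inj₂ (used , len , stuck) = inj₂ (used , ℕ.≤-trans len (ℕ.*-monoʳ-≤ 4 (ℕ.n≤1+n k)) , stuck)
    ... | inj₁ (used , len , s)
      with any? (λ u → any? λ v → any? λ z → any? λ w → candidate? used u v z w)
    ... | no ¬p = inj₂ (used , ℕ.≤-trans len (ℕ.*-monoʳ-≤ 4 (ℕ.n≤1+n k)) ,
                         λ u v z w p → ¬p (u , v , z , w , p))
    ... | yes (u , v , z , w , (u∉ , v∉ , z∉ , w∉) , (uv , zw , zu , zv , wu , wv) , alt≢0) =
      inj₁ (_ , subst (4 ℕ.+ length used ℕ.≤_) (sym (ℕ.*-suc 4 k)) (ℕ.+-monoʳ-≤ 4 len)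
              , extend s u∉ v∉ id id uv zw zu zv wu wv (Switches.unused s z∉) (Switches.unused s w∉) alt≢0)

    Independent : List V → Set
    Independent L = ∀ {x y} → x ∉ L → y ∉ L → ¬ Adj x y

    -- Given an edge x y outside L, take non-neighbours v of x and t of y; the
    -- alternating sum of x t and y v is then 1 + a t v.
    stuck⇒independent : ∀ {L} → (∀ x → degree x ℕ.+ (3 ℕ.+ length L) ℕ.< n) → Stuck L → Independent L
    stuck⇒independent {L} room stuck {x} {y} x∉ y∉ xy
      -- A vertex is its own non-neighbour, so x has to be excluded. It is listed twice so that both
      -- exclusion lists have the length that `room` allows for.
      with v , ¬xv , v∉ ← ∃-non-neighbour x (x ∷ x ∷ y ∷ L) (room x)
      with t , ¬yt , t∉ ← ∃-non-neighbour y (x ∷ y ∷ v ∷ L) (room y)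
      = stuck x t y v ((x∉ , t∉ ∘ there ∘ there ∘ there , y∉ , v∉ ∘ there ∘ there ∘ there)
          , ( ∉⇒≢ (here refl) t∉ , ∉⇒≢ (there (there (here refl))) v∉ , Adj⇒≢ (Adj-sym xy)
            , ∉⇒≢ (there (here refl)) t∉ , ∉⇒≢ (here refl) v∉ ∘ sym , ∉⇒≢ (there (there (here refl))) t∉)
          , alt≢0)
      where
      alt≢0 : alt a x t y v ≢ 0ℤ
      alt≢0 rewrite ⟦⟧-yes (adj? x y) xy | ⟦⟧-no (adj? t y) (¬yt ∘ Adj-sym) | ⟦⟧-no (adj? x v) ¬xv with adj? t v
      ... | yes _ = λ ()
      ... | no  _ = λ ()

    module _ {L : List V} {m : ℕ} (ind : Independent L) {w₀ : V} (w₀∉ : w₀ ∉ L)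
             (len : length L ℕ.≤ 4 ℕ.* m)
             (room : ∀ x → degree x ℕ.+ (8 ℕ.* m ℕ.+ 10) ℕ.≤ n)
             (no-isolated : ∀ v → ∃ λ u → Adj v u) where

      private
        bound : ∀ k → k ℕ.≤ m → suc (1 ℕ.+ 4 ℕ.* m ℕ.+ 4 ℕ.* k) ℕ.≤ 8 ℕ.* m ℕ.+ 10
        bound k k≤m = begin
          suc (1 ℕ.+ 4 ℕ.* m ℕ.+ 4 ℕ.* k) ≤⟨ ℕ.+-monoʳ-≤ (2 ℕ.+ 4 ℕ.* m) (ℕ.*-monoʳ-≤ 4 k≤m) ⟩
          2 ℕ.+ 4 ℕ.* m ℕ.+ 4 ℕ.* m       ≡⟨ cong (2 ℕ.+_) (sym (ℕ.*-distribʳ-+ m 4 4)) ⟩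
          2 ℕ.+ 8 ℕ.* m                   ≡⟨ ℕ.+-comm 2 (8 ℕ.* m) ⟩
          8 ℕ.* m ℕ.+ 2                   ≤⟨ ℕ.+-monoʳ-≤ (8 ℕ.* m) (s≤s (s≤s z≤n)) ⟩
          8 ℕ.* m ℕ.+ 10                  ∎
          where open ℕ.≤-Reasoning
        arith : ∀ k → 4 ℕ.+ (1 ℕ.+ 4 ℕ.* m ℕ.+ 4 ℕ.* k) ≡ 1 ℕ.+ 4 ℕ.* m ℕ.+ 4 ℕ.* suc k
        arith k = trans (sym (ℕ.+-comm (1 ℕ.+ 4 ℕ.* m ℕ.+ 4 ℕ.* k) 4))
          (trans (ℕ.+-assoc (1 ℕ.+ 4 ℕ.* m) (4 ℕ.* k) 4)
            (cong (1 ℕ.+ 4 ℕ.* m ℕ.+_) (trans (ℕ.+-comm (4 ℕ.* k) 4) (sym (ℕ.*-suc 4 k)))))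
        alt≢0 : ∀ {u v z w} → Adj u z → ¬ Adj v z → ¬ Adj u w → ¬ Adj v w → alt a u v z w ≢ 0ℤ
        alt≢0 {u} {v} {z} {w} uz vz uw vw
          rewrite ⟦⟧-yes (adj? u z) uz | ⟦⟧-no (adj? v z) vz | ⟦⟧-no (adj? u w) uw | ⟦⟧-no (adj? v w) vw = λ ()

      greedy-independent : ∀ k → k ℕ.≤ m → ∃ λ used → length used ℕ.≤ 1 ℕ.+ 4 ℕ.* m ℕ.+ 4 ℕ.* k
        × (∀ {x} → x ∈ w₀ ∷ L → x ∈ used) × Switches (_∈ w₀ ∷ L) k used
      greedy-independent zero k≤m = w₀ ∷ L , s≤s (subst (length L ℕ.≤_) (sym (ℕ.+-identityʳ _)) len) , id , empty _ _
      greedy-independent (suc k) k<m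
        with used , len′ , L⊆used , s ← greedy-independent k (ℕ.<⇒≤ k<m)
        with used<  ← ℕ.≤-trans (s≤s len′) (bound k (ℕ.<⇒≤ k<m))
        with u , u∉ ← ∃∉ used (ℕ.≤-trans used< (ℕ.≤-trans (ℕ.m≤n+m _ (degree w₀)) (room w₀)))
        with z , uz ← no-isolated u
        with v , ¬zv , v∉ ← ∃-non-neighbour z used (ℕ.≤-trans (ℕ.+-monoʳ-< (degree z) used<) (room z))
        with z∈ ← decidable-stable (z ∈? L) (λ z∉ → ind (u∉ ∘ L⊆used ∘ there) z∉ uz)
        = _ , subst (4 ℕ.+ length used ℕ.≤_) (arith k) (ℕ.+-monoʳ-≤ 4 len′) , there ∘ there ∘ there ∘ there ∘ L⊆used
        , extend s u∉ v∉ (u∉ ∘ L⊆used) (v∉ ∘ L⊆used) (λ { refl → ¬zv (Adj-sym uz) }) (∉⇒≢ z∈ w₀∉)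
            (Adj⇒≢ (Adj-sym uz)) (∉⇒≢ (L⊆used (there z∈)) v∉) (∉⇒≢ (L⊆used (here refl)) u∉) (∉⇒≢ (L⊆used (here refl)) v∉)
            (Switches.fixed s (there z∈)) (Switches.fixed s (here refl))
            (alt≢0 uz (¬zv ∘ Adj-sym) (ind (u∉ ∘ L⊆used ∘ there) w₀∉) (ind (v∉ ∘ L⊆used ∘ there) w₀∉))

    length-bound : ∀ m (L : List V) → length L ℕ.≤ 4 ℕ.* m → 4 ℕ.+ length L ℕ.≤ 8 ℕ.* m ℕ.+ 10
    length-bound m L len = subst (4 ℕ.+ length L ℕ.≤_) (ℕ.+-comm 10 (8 ℕ.* m))
      (ℕ.+-mono-≤ {4} {10} {length L} {8 ℕ.* m} (s≤s (s≤s (s≤s (s≤s z≤n)))) (ℕ.≤-trans len (ℕ.*-monoˡ-≤ m {4} {8} (s≤s (s≤s (s≤s (s≤s z≤n)))))))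

    module _ (m : ℕ) (room : ∀ x → degree x ℕ.+ (8 ℕ.* m ℕ.+ 10) ℕ.≤ n)
             (no-isolated : ∀ v → ∃ λ u → Adj v u) (v₀ : V) where

      switches-stuck : ∀ {L} → length L ℕ.≤ 4 ℕ.* m → Stuck L → ∃ λ P → ∃ λ used → Switches P m used
      switches-stuck {L} len stuck = _ , proj₁ result , proj₂ (proj₂ (proj₂ result))
        where
        unused : ∃ λ w₀ → w₀ ∉ L
        unused = ∃∉ L (ℕ.≤-trans (s≤s (ℕ.m≤n+m (length L) 3))
          (ℕ.≤-trans (length-bound m L len) (ℕ.≤-trans (ℕ.m≤n+m _ (degree v₀)) (room v₀))))
        independent : Independent L
        independent = stuck⇒independent
          (λ x → ℕ.≤-trans (ℕ.+-monoʳ-< (degree x) (length-bound m L len)) (room x)) stuck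
        result = greedy-independent independent (proj₂ unused) len room no-isolated m ℕ.≤-refl

      many-switches : ∃ λ P → ∃ λ used → Switches P m used
      many-switches with greedy m
      ... | inj₁ (used , _ , s)      = _ , used , s
      ... | inj₂ (L , len , stuck) = switches-stuck len stuck

  -- The numerical contradiction.

  -- 13200 = 33 · 400 makes K at most m / 400, so that 100 Q ≤ N and the error
  -- term 36 Q stays well below N.
  numeric-contradiction : ∀ {n M m K N Q Ξ S Φ : ℤ} →
    + 1000 ≤ M → M ≤ n → M ≤ + 16 * m + + 15 → 0ℤ ≤ K → 1ℤ ≤ N →
    K * + 13200 ≤ + 2 * M + 1ℤ →
    m * Q ≤ + 4 * K * N →
    N ≤ + 3 * Ξ + + 36 * Q →
    n * (n * (n * (n * Ξ))) - + 2 * N * (+ 6 * (n * (n * n))) ≤ S * S * N →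
    abs S * N ≤ n * (n * Φ) + n * N →
    n * Φ ≤ K * N → 1ℤ ≤ 0ℤ
  numeric-contradiction {n} {M} {m} {K} {N} {Q} {Ξ} {S} {Φ} M≥ M≤n M≤m 0≤K 1≤N hK hQ hN hΞ hS hΦ =
    -- The constant is 63 · 1000 - 3600 - 1.
    ≤-by (eq n) (0≤+ (0≤+ (0≤-of 63n≤3600) (0≤* {+ 63} 0≤+n (0≤-of n≥))) (0≤+n {59399}))
    where
    n≥ : + 1000 ≤ n
    n≥ = ℤ.≤-trans M≥ M≤n
    1≤n : 1ℤ ≤ n
    1≤n = ℤ.≤-trans (+≤+ (s≤s z≤n)) n≥
    0≤n : 0ℤ ≤ n
    0≤n = ℤ.≤-trans 0≤+n 1≤n
    0≤N : 0ℤ ≤ N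
    0≤N = ℤ.≤-trans 0≤+n 1≤N
    L : ℤ
    -- The summand 1 comes from the diagonal term of `S-bound`.
    L = K + 1ℤ
    0≤L : 0ℤ ≤ L
    0≤L = 0≤+ 0≤K 0≤+n

    m≥ : + 31 ≤ m
    m≥ = cancel-≤ (+ 16) (+≤+ (s≤s z≤n)) (≤-by (eq M m)
      (0≤+ (0≤+ (0≤-of M≤m) (0≤-of M≥)) (0≤+n {489})))
      where
      eq : ∀ M m → + 16 * m - + 16 * + 31 ≡ ((+ 16 * m + + 15 - M) + (M - + 1000)) + + 489
      eq = solve-∀

    1≤m : 1ℤ ≤ m
    1≤m = ℤ.≤-trans (+≤+ (s≤s z≤n)) m≥

    K≤m : + 400 * K ≤ m
    -- 13200 K ≤ 2M + 1 ≤ 32m + 31 ≤ 33m, the last because m ≥ 31.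
    K≤m = cancel-≤ (+ 33) (+≤+ (s≤s z≤n)) (≤-by (eq M m K)
      (0≤+ (0≤+ (0≤-of hK) (0≤* {+ 2} 0≤+n (0≤-of M≤m))) (0≤-of m≥)))
      where
      eq : ∀ M m K → + 33 * m - + 33 * (+ 400 * K) ≡
           ((+ 2 * M + 1ℤ - K * + 13200) + + 2 * (+ 16 * m + + 15 - M)) + (m - + 31)
      eq = solve-∀

    Q≤N : + 100 * Q ≤ N
    Q≤N = cancel-≤ m 1≤m (≤-by (eq m K N Q)
      (0≤+ (0≤* {+ 100} 0≤+n (0≤-of hQ)) (0≤* 0≤N (0≤-of K≤m))))
      where
      eq : ∀ m K N Q → m * N - m * (+ 100 * Q) ≡ + 100 * (+ 4 * K * N - m * Q) + N * (m - + 400 * K)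
      eq = solve-∀

    N≤Ξ : + 64 * N ≤ + 300 * Ξ
    -- 64 = 100 - 36: the error 36 `Q` is at most 36/100 of `N`.
    N≤Ξ = ≤-by (eq N Ξ Q) (0≤+ (0≤* {+ 100} 0≤+n (0≤-of hN)) (0≤* {+ 36} 0≤+n (0≤-of Q≤N)))
      where
      eq : ∀ N Ξ Q → + 300 * Ξ - + 64 * N ≡ + 100 * (+ 3 * Ξ + + 36 * Q - N) + + 36 * (N - + 100 * Q)
      eq = solve-∀

    S≤nL : abs S ≤ n * L
    S≤nL = cancel-≤ N 1≤N (≤-by (eq n N K Φ (abs S)) (0≤+ (0≤-of hS) (0≤* 0≤n (0≤-of hΦ))))
      where
      eq : ∀ n N K Φ s → N * (n * (K + 1ℤ)) - N * s ≡ (n * (n * Φ) + n * N - s * N) + n * (K * N - n * Φ)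
      eq = solve-∀

    S²≤ : S * S ≤ n * L * (n * L)
    S²≤ = ℤ.≤-trans (ℤ.≤-trans (≤-abs (S * S)) (ℤ.≤-reflexive (abs-* S S)))
      (≤-by (eq (abs S) (n * L)) (0≤* (0≤-of S≤nL) (0≤+ (0≤* 0≤n 0≤L) 0≤+n)))
      where
      eq : ∀ s b → b * b - s * s ≡ (b - s) * (b + s)
      eq = solve-∀

    L≤n : + 800 * L ≤ n
    L≤n = cancel-≤ (+ 33) (+≤+ (s≤s z≤n)) (≤-by (eq n M K)
      (0≤+ (0≤+ (0≤+ (0≤* {+ 2} 0≤+n (0≤-of hK)) (0≤* {+ 4} 0≤+n (0≤-of M≤n)))
        (0≤* {+ 29} 0≤+n (0≤-of n≥))) (0≤+n {2598})))
      where
      eq : ∀ n M K → + 33 * n - + 33 * (+ 800 * (K + 1ℤ)) ≡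
           ((+ 2 * (+ 2 * M + 1ℤ - K * + 13200) + + 4 * (n - M)) + + 29 * (n - + 1000)) + + 2598
      eq = solve-∀

    L²≤ : + 300 * (L * L) ≤ n * n
    -- n² - 300L² = (n - 20L)(n + 20L) + 100L², and n ≥ 800L leaves ample room.
    L²≤ = ≤-by (eq n L) (0≤+ (0≤* (0≤+ (0≤-of L≤n) (0≤* {+ 780} 0≤+n 0≤L)) (0≤+ 0≤n (0≤* {+ 20} 0≤+n 0≤L)))
      (0≤* {+ 100} 0≤+n (0≤* 0≤L 0≤L)))
      where
      eq : ∀ n L → n * n - + 300 * (L * L) ≡
           ((n - + 800 * L) + + 780 * L) * (n + + 20 * L) + + 100 * (L * L)
      eq = solve-∀

    n²≤ : + 64 * (n * n) ≤ + 300 * (L * L) + + 3600 * n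
    -- 300 times the bound on `Ξ`, whose error 12 N n³ becomes 3600 N n³, with the bounds on `Ξ`
    -- from below and on S² inserted.
    n²≤ = cancel-≤ (N * (n * n)) (1≤* 1≤N (1≤* 1≤n 1≤n)) (≤-by (eq n N Ξ S L)
      (0≤+ (0≤+ (0≤* {+ 300} 0≤+n (0≤-of hΞ)) (0≤* (0≤* (0≤* 0≤n 0≤n) (0≤* 0≤n 0≤n)) (0≤-of N≤Ξ)))
        (0≤* (0≤* {+ 300} 0≤+n 0≤N) (0≤-of S²≤))))
      where
      1≤* : ∀ {x y} → 1ℤ ≤ x → 1ℤ ≤ y → 1ℤ ≤ x * y
      1≤* {x} {y} 1≤x 1≤y = ≤-by (eq′ x y) (0≤+ (0≤* (0≤-of 1≤x) (ℤ.≤-trans 0≤+n 1≤y)) (0≤-of 1≤y))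
        where
        eq′ : ∀ x y → x * y - 1ℤ ≡ (x - 1ℤ) * y + (y - 1ℤ)
        eq′ = solve-∀
      eq : ∀ n N Ξ S L →
        N * (n * n) * (+ 300 * (L * L) + + 3600 * n) - N * (n * n) * (+ 64 * (n * n)) ≡
        (+ 300 * (S * S * N - (n * (n * (n * (n * Ξ))) - + 2 * N * (+ 6 * (n * (n * n)))))
          + n * n * (n * n) * (+ 300 * Ξ - + 64 * N))
        + + 300 * N * (n * L * (n * L) - S * S)
      eq = solve-∀

    63n≤3600 : + 63 * n ≤ + 3600
    63n≤3600 = cancel-≤ n 1≤n (≤-by (eq n L) (0≤+ (0≤-of n²≤) (0≤-of L²≤)))
      where
      eq : ∀ n L → n * + 3600 - n * (+ 63 * n) ≡
        (+ 300 * (L * L) + + 3600 * n - + 64 * (n * n)) + (n * n - + 300 * (L * L))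
      eq = solve-∀

    eq : ∀ n → 0ℤ - 1ℤ ≡ ((+ 3600 - + 63 * n) + + 63 * (n - + 1000)) + + 59399
    eq = solve-∀

  -- A placement with large |D|.

  module Main {n : ℕ} (F : Graph n) (no-isolated : Graph.NoIsolatedVertices F) (col : Colouring n) where
    open Greedy F
    open Colouring col renaming (colour to c; colour-sym to c-sym)
    open Average n
    open Colours c c-sym using (f; f-sym; module Uniform)
    open Switching a f a-sym f-sym
    private V = Fin n

    D-Ext : Ext D
    D-Ext eq = Σ₂-cong (λ u v → cong₂ (λ x y → a u v * f x y) (eq u) (eq v))

    module Bounded (12≤n : 12 ℕ.≤ n) (K : ℤ) (bound : ∀ π → Inj π → abs (D π) ≤ K) where
      open Uniform 12≤n

      E-|D|≤ : E (λ π → abs (D π)) ≤ K * N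
      E-|D|≤ = ℤ.≤-trans (E-mono bound) (ℤ.≤-reflexive (E-const K))

      E-D : E D ≡ Φ * Σ₂ a
      E-D = begin
        E D                                                      ≡⟨ E-Σ₂ (λ u v π → a u v * f (π u) (π v)) ⟩
        Σ₂ (λ u v → E (λ π → a u v * f (π u) (π v)))             ≡⟨ Σ₂-cong (λ u v → E-* (a u v) (λ π → f (π u) (π v))) ⟩
        Σ₂ (λ u v → a u v * E (λ π → f (π u) (π v)))             ≡⟨ Σ₂-cong edge ⟩
        Σ₂ (λ u v → Φ * a u v)                                   ≡⟨ Σ₂-scale Φ a ⟩
        Φ * Σ₂ a                                                 ∎
        where
        open ≡-Reasoning
        edge : ∀ u v → a u v * E (λ π → f (π u) (π v)) ≡ Φ * a u v
        edge u v with Graph.adj? F u v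
        ... | yes uv = trans (cong (1ℤ *_) (E-f (Adj⇒≢ uv))) (ℤ.*-comm 1ℤ Φ)
        ... | no  _  = trans (ℤ.*-zeroˡ (E (λ π → f (π u) (π v)))) (sym (ℤ.*-zeroʳ Φ))

      n≤Σa : + n ≤ Σ₂ a
      n≤Σa = subst (_≤ Σ₂ a) (trans (∑-const n 1ℤ) (ℤ.*-identityʳ (+ n))) (∑-mono row)
        where
        row : ∀ u → 1ℤ ≤ ∑ (a u)
        row u with v , uv ← no-isolated u =
          subst (_≤ ∑ (a u)) (⟦⟧-yes (Graph.adj? F u v) uv) (term≤∑ (λ w → ⟦⟧-nonneg (Graph.adj? F u w)) v)

      -- The mean of `D` is the mean colour times the number of ordered adjacent pairs, which is at
      -- least n because no vertex is isolated.
      nΦ≤KN : + n * abs Φ ≤ K * N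
      nΦ≤KN = begin
        + n * abs Φ             ≤⟨ ℤ.*-monoʳ-≤-nonNeg (abs Φ) n≤Σa ⟩
        Σ₂ a * abs Φ            ≤⟨ ℤ.*-monoʳ-≤-nonNeg (abs Φ) (≤-abs (Σ₂ a)) ⟩
        abs (Σ₂ a) * abs Φ      ≡⟨ trans (ℤ.*-comm (abs (Σ₂ a)) (abs Φ)) (sym (abs-* Φ (Σ₂ a))) ⟩
        abs (Φ * Σ₂ a)          ≡⟨ cong abs (sym E-D) ⟩
        abs (E D)               ≤⟨ abs-E D ⟩
        E (λ π → abs (D π))     ≤⟨ E-|D|≤ ⟩
        K * N                   ∎
        where open ℤ.≤-Reasoning

      module _ {P : V → Set} {m : ℕ} {used} (s : Switches P m used) where
        open Switches s
        open Involution τ τ-inv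

        χQ≤E|T| : ∀ x → χ x * Q ≤ E (λ π → abs (T π x))
        χQ≤E|T| x with χ-cases x
        ... | inj₁ χx≡0 rewrite χx≡0 = subst (_≤ E (λ π → abs (T π x))) (sym (ℤ.*-zeroˡ Q)) (E-nonneg (λ π → 0≤+n))
        ... | inj₂ (χx≡1 , W) rewrite χx≡1 = begin
          1ℤ * Q                                                    ≡⟨ ℤ.*-identityˡ Q ⟩
          Q                                                         ≡⟨ sym (E-alt (τx≢x ∘ sym) (z≢x ∘ sym) (w≢x ∘ sym)
                                                                         (τx≢ z≢x τz) (τx≢ w≢x τw) z≢w) ⟩
          E (λ π → abs (alt f (π x) (π (τ x)) (π z) (π w)))          ≤⟨ E-alt≤E-T z≢w z≢x w≢x τz τw alt≢0 ⟩
          E (λ π → abs (T π x))                                      ∎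
          where
          open ℤ.≤-Reasoning
          open Witness W
          τx≢ : ∀ {y} → y ≢ x → τ y ≡ y → τ x ≢ y
          τx≢ y≢x τy τx≡y = y≢x (trans (sym τy) (trans (cong τ (sym τx≡y)) (τ-inv x)))

        0≤Q : 0ℤ ≤ Q
        0≤Q = E-nonneg (λ π → 0≤+n)

        -- Double counting of the total of `|T|`: each marked vertex contributes at least `Q` on
        -- average, while for each bijection the whole sum is at most 4K.
        mQ≤4KN : + m * Q ≤ + 4 * K * N
        mQ≤4KN = begin
          + m * Q                                 ≤⟨ ≤-by (eq (+ m) (∑ χ) Q) (0≤* (0≤-of χ-sum) 0≤Q) ⟩
          Q * ∑ χ                                 ≡⟨ trans (sym (∑-scale Q χ)) (∑-cong (λ x → ℤ.*-comm Q (χ x))) ⟩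
          ∑ (λ x → χ x * Q)                       ≤⟨ ∑-mono χQ≤E|T| ⟩
          ∑ (λ x → E (λ π → abs (T π x)))          ≡⟨ sym (E-∑ (λ x π → abs (T π x))) ⟩
          E (λ π → ∑ (λ x → abs (T π x)))          ≤⟨ E-mono (Σ-abs-≤ bound) ⟩
          E (λ _ → + 4 * K)                        ≡⟨ E-const (+ 4 * K) ⟩
          + 4 * K * N                              ∎
          where
          open ℤ.≤-Reasoning
          eq : ∀ m s q → q * s - m * q ≡ (s - m) * q
          eq = solve-∀

    -- The factor 2 is there because `D` counts every edge twice. The bound has `suc M` so that it
    -- survives rounding when M is the integer part of εn.
    large-|D| : ∀ M → 1000 ℕ.≤ M → (∀ x → Graph.degree F x ℕ.+ M ℕ.≤ n) → V →
                ∃ λ π → Inj π × 2 ℕ.* suc M ℕ.≤ ∣ D π ∣ ℕ.* 13200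
    large-|D| M 1000≤M room v₀ with search (λ eq → cong (λ x → + (∣ x ∣ ℕ.* 13200)) (D-Ext eq)) (+ (2 ℕ.* suc M))
    ... | inj₁ (π , inj , le) = π , inj , ℤ.drop‿+≤+ le
    ... | inj₂ small = contradiction
      (numeric-contradiction {+ n} {+ M} {+ m} {+ K} {N} {Q} {Ξ} {S} {abs Φ} (+≤+ 1000≤M) (+≤+ M≤n) M≤ 0≤+n 1≤N K≤ (mQ≤4KN s) N≤3Ξ+36Q Ξ-bound S-bound nΦ≤KN)
      λ { (+≤+ ()) }
      where
      M≤n : M ℕ.≤ n
      M≤n = ℕ.≤-trans (ℕ.m≤n+m M _) (room v₀)
      12≤n : 12 ℕ.≤ n
      12≤n = ℕ.≤-trans (ℕ.m≤m+n 12 988) (ℕ.≤-trans 1000≤M M≤n)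
      -- Dividing by 16 keeps 8m + 10 below M. If the search fails, 13200 |D| ≤ 2M + 1 everywhere,
      -- and `K` is the resulting integer bound.
      m K : ℕ
      m = M ℕ./ 16
      K = (2 ℕ.* M ℕ.+ 1) ℕ./ 13200
      |D|≤K : ∀ π → Inj π → abs (D π) ≤ + K
      |D|≤K π inj = +≤+ (subst (ℕ._≤ K) (ℕ.m*n/n≡m ∣ D π ∣ 13200) (ℕ./-monoˡ-≤ 13200 (begin
        ∣ D π ∣ ℕ.* 13200   ≤⟨ ℕ.≤-pred (ℤ.drop‿+<+ (small π inj)) ⟩
        ℕ.pred (2 ℕ.* suc M) ≡⟨ cong ℕ.pred (ℕ.*-suc 2 M) ⟩
        1 ℕ.+ 2 ℕ.* M       ≡⟨ ℕ.+-comm 1 (2 ℕ.* M) ⟩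
        2 ℕ.* M ℕ.+ 1       ∎)))
        where open ℕ.≤-Reasoning
      open Bounded 12≤n (+ K) |D|≤K
      open Uniform 12≤n using (Q; Ξ; S; Φ; N≤3Ξ+36Q; Ξ-bound; S-bound)
      K≤ : + K * + 13200 ≤ + 2 * + M + 1ℤ
      K≤ = subst₂ _≤_ (ℤ.pos-* K 13200) (cong (_+ 1ℤ) (ℤ.pos-* 2 M))
        (+≤+ (ℕ.m/n*n≤m (2 ℕ.* M ℕ.+ 1) 13200))
      M≡ : M ≡ M ℕ.% 16 ℕ.+ m ℕ.* 16
      M≡ = ℕ.m≡m%n+[m/n]*n M 16
      M≤ : + M ≤ + 16 * + m + + 15
      M≤ = subst (+ M ≤_) (cong (_+ + 15) (trans (cong +_ (ℕ.*-comm m 16)) (ℤ.pos-* 16 m))) (+≤+ (begin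
        M                         ≡⟨ M≡ ⟩
        M ℕ.% 16 ℕ.+ m ℕ.* 16     ≤⟨ ℕ.+-monoˡ-≤ (m ℕ.* 16) (ℕ.≤-pred (ℕ.m%n<n M 16)) ⟩
        15 ℕ.+ m ℕ.* 16           ≡⟨ ℕ.+-comm 15 (m ℕ.* 16) ⟩
        m ℕ.* 16 ℕ.+ 15           ∎))
        where open ℕ.≤-Reasoning
      8m+10≤M : 8 ℕ.* m ℕ.+ 10 ℕ.≤ M
      8m+10≤M = ℕ.*-cancelˡ-≤ 2 (begin
        2 ℕ.* (8 ℕ.* m ℕ.+ 10)    ≡⟨ ℕ.*-distribˡ-+ 2 (8 ℕ.* m) 10 ⟩
        2 ℕ.* (8 ℕ.* m) ℕ.+ 20    ≡⟨ cong (ℕ._+ 20) (trans (sym (ℕ.*-assoc 2 8 m)) (ℕ.*-comm 16 m)) ⟩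
        m ℕ.* 16 ℕ.+ 20           ≤⟨ ℕ.+-mono-≤ (ℕ.m/n*n≤m M 16) (ℕ.≤-trans (ℕ.m≤m+n 20 980) 1000≤M) ⟩
        M ℕ.+ M                   ≡⟨ cong (M ℕ.+_) (sym (ℕ.+-identityʳ M)) ⟩
        2 ℕ.* M                   ∎)
        where open ℕ.≤-Reasoning
      switches = many-switches m (λ x → ℕ.≤-trans (ℕ.+-monoʳ-≤ (Graph.degree F x) 8m+10≤M) (room x)) no-isolated v₀
      s = proj₂ (proj₂ switches)

  -- The discrepancy of a placed copy.

  total : List ℤ → ℤ
  total = foldr _+_ 0ℤ

  total-++ : ∀ xs ys → total (xs ++ ys) ≡ total xs + total ys
  total-++ []       ys = sym (ℤ.+-identityˡ _)
  total-++ (x ∷ xs) ys = trans (cong (λ t → x + t) (total-++ xs ys)) (sym (ℤ.+-assoc x _ _))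

  total-filter : ∀ {A : Set} {P : A → Set} (P? : ∀ x → Dec (P x)) (h : A → ℤ) xs →
                 total (map h (filter P? xs)) ≡ total (map (λ x → ⟦ P? x ⟧ * h x) xs)
  total-filter P? h [] = refl
  total-filter P? h (x ∷ xs) with P? x
  ... | yes _ = cong₂ _+_ (sym (ℤ.*-identityˡ (h x))) (total-filter P? h xs)
  ... | no  _ = trans (total-filter P? h xs) (sym (trans (cong (_+ rest) (ℤ.*-zeroˡ (h x))) (ℤ.+-identityˡ rest)))
    where
    rest : ℤ
    rest = total (map (λ x → ⟦ P? x ⟧ * h x) xs)

  total-allFin : (h : Fin n → ℤ) → total (map h (allFin n)) ≡ ∑ h
  total-allFin {n} h = trans (cong total (map-tabulate id h)) (total-tabulate h)
    where
    total-tabulate : ∀ {n} (h : Fin n → ℤ) → total (tabulate h) ≡ ∑ h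
    total-tabulate {zero}  h = sym (∑-zero h)
    total-tabulate {suc n} h = trans (cong (λ t → h zero + t) (total-tabulate (h ∘ suc))) (sym (∑-suc h))

  total-product : (h : Fin n × Fin n → ℤ) →
                  total (map h (cartesianProduct (allFin n) (allFin n))) ≡ Σ₂ (λ x y → h (x , y))
  total-product {n} h = trans (go (allFin n)) (total-allFin (λ x → ∑ (λ y → h (x , y))))
    where
    go : ∀ xs → total (map h (cartesianProduct xs (allFin n))) ≡ total (map (λ x → ∑ (λ y → h (x , y))) xs)
    go [] = refl
    go (x ∷ xs) = trans (cong total (map-++ h (map (x ,_) (allFin n)) (cartesianProduct xs (allFin n))))
      (trans (total-++ (map h (map (x ,_) (allFin n))) _)
        (cong₂ _+_ (trans (cong total (sym (map-∘ (allFin n)))) (total-allFin (λ y → h (x , y)))) (go xs)))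

  module Copy {n : ℕ} (F : Graph n) (col : Colouring n) (π : Fin n → Fin n) (inj : Inj π) where
    open Graph F using (Adj; adj?) renaming (sym to Adj-sym; irrefl to Adj-irrefl)
    open Greedy F using (a; a-sym)
    open Colouring col renaming (colour to c; colour-sym to c-sym)
    open Colours c c-sym using (f; f-sym)
    open Switching a f a-sym f-sym using (D)
    private
      V = Fin n
      σ : Permutation′ n
      σ = Inj⇒permutation π inj
      π⁻¹ : V → V
      π⁻¹ = σ ⟨$⟩ˡ_
      π⁻¹π : ∀ u → π⁻¹ (π u) ≡ u
      π⁻¹π u = Perm.inverseˡ σ
      ππ⁻¹ : ∀ x → π (π⁻¹ x) ≡ x
      ππ⁻¹ x = Perm.inverseʳ σ

    -- The image of F under π, described through the inverse so that symmetry and decidability are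
    -- inherited directly.
    H : Subgraph (complete n)
    H = record
      { vertices = Subset.⊤
      ; Adj      = λ x y → Adj (π⁻¹ x) (π⁻¹ y)
      ; sym      = Adj-sym
      ; adj?     = λ x y → adj? (π⁻¹ x) (π⁻¹ y)
      ; Adj⇒∈    = λ _ → ∈⊤
      ; Adj⇒G    = λ xy x≡y → Adj-irrefl (cong π⁻¹ x≡y) xy
      }

    isCopy : IsCopyOf F H
    isCopy = record
      { bijection = mk↔ₛ′ (λ u → π u , ∈⊤) (π⁻¹ ∘ proj₁)
          (λ { (x , x∈) → vertex-≡ (ππ⁻¹ x) }) π⁻¹π
      ; adj⇔ = λ u v → mk⇔ (subst₂ Adj (sym (π⁻¹π u)) (sym (π⁻¹π v))) (subst₂ Adj (π⁻¹π u) (π⁻¹π v))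
      }
      where
      vertex-≡ : ∀ {x y : V} {x∈ : x Subset.∈ Subset.⊤} {y∈ : y Subset.∈ Subset.⊤} → x ≡ y → (x , x∈) ≡ (y , y∈)
      vertex-≡ {x} refl = cong (x ,_) ([]=-irrelevant _ _)

    private
      listed? : ∀ (p : V × V) → Dec (proj₁ p Fin.< proj₂ p × Adj (π⁻¹ (proj₁ p)) (π⁻¹ (proj₂ p)))
      listed? (x , y) = (x Fin.<? y) ×-dec adj? (π⁻¹ x) (π⁻¹ y)

      W : V → V → ℤ
      W x y = ⟦ listed? (x , y) ⟧ * f x y

      -- `edges` lists an edge with its smaller endpoint first, so exactly one of the two
      -- orientations of an adjacent pair passes the test.
      split : ∀ x y → a (π⁻¹ x) (π⁻¹ y) * f x y ≡ W x y + W y x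
      split x y = trans (cong (_* f x y) indicator)
        (trans (ℤ.*-distribʳ-+ (f x y) ⟦ listed? (x , y) ⟧ ⟦ listed? (y , x) ⟧)
          (cong (λ t → W x y + ⟦ listed? (y , x) ⟧ * t) (f-sym x y)))
        where
        indicator : a (π⁻¹ x) (π⁻¹ y) ≡ ⟦ listed? (x , y) ⟧ + ⟦ listed? (y , x) ⟧
        indicator = cases (adj? (π⁻¹ x) (π⁻¹ y)) (Fin.<-cmp x y)
          where
          values : ∀ {i j} → a (π⁻¹ x) (π⁻¹ y) ≡ i + j → ⟦ listed? (x , y) ⟧ ≡ i → ⟦ listed? (y , x) ⟧ ≡ j →
                   a (π⁻¹ x) (π⁻¹ y) ≡ ⟦ listed? (x , y) ⟧ + ⟦ listed? (y , x) ⟧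
          values eq refl refl = eq
          cases : Dec (Adj (π⁻¹ x) (π⁻¹ y)) → Tri (x Fin.< y) (x ≡ y) (y Fin.< x) →
                  a (π⁻¹ x) (π⁻¹ y) ≡ ⟦ listed? (x , y) ⟧ + ⟦ listed? (y , x) ⟧
          cases (no ¬xy) _ = values (⟦⟧-no (adj? _ _) ¬xy)
            (⟦⟧-no (listed? (x , y)) (¬xy ∘ proj₂)) (⟦⟧-no (listed? (y , x)) (¬xy ∘ Adj-sym ∘ proj₂))
          cases (yes xy) (tri< x<y _ y≮x) = values (⟦⟧-yes (adj? _ _) xy)
            (⟦⟧-yes (listed? (x , y)) (x<y , xy)) (⟦⟧-no (listed? (y , x)) (y≮x ∘ proj₁))
          cases (yes xy) (tri≈ _ x≡y _)   = contradiction xy (Adj-irrefl (cong π⁻¹ x≡y))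
          cases (yes xy) (tri> x≮y _ y<x) = values (⟦⟧-yes (adj? _ _) xy)
            (⟦⟧-no (listed? (x , y)) (x≮y ∘ proj₁)) (⟦⟧-yes (listed? (y , x)) (y<x , Adj-sym xy))

    D≡2W : D π ≡ + 2 * Σ₂ W
    D≡2W = begin
      Σ₂ (λ u v → a u v * f (π u) (π v))
        ≡⟨ Σ₂-cong (λ u v → cong₂ (λ x y → a x y * f (π u) (π v)) (sym (π⁻¹π u)) (sym (π⁻¹π v))) ⟩
      Σ₂ (λ u v → a (π⁻¹ (π u)) (π⁻¹ (π v)) * f (π u) (π v))
        ≡⟨ Σ₂-Inj π inj (λ x y → a (π⁻¹ x) (π⁻¹ y) * f x y) ⟩
      Σ₂ (λ x y → a (π⁻¹ x) (π⁻¹ y) * f x y)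
        ≡⟨ Σ₂-cong split ⟩
      Σ₂ (λ x y → W x y + W y x)
        ≡⟨ trans (Σ₂-+ W (λ x y → W y x)) (cong (λ t → Σ₂ W + t) (sym (Σ₂-swap W))) ⟩
      Σ₂ W + Σ₂ W
        ≡⟨ eq (Σ₂ W) ⟩
      + 2 * Σ₂ W ∎
      where
      open ≡-Reasoning
      eq : ∀ x → x + x ≡ + 2 * x
      eq = solve-∀

    discrepancy≡ : 2 ℕ.* discrepancy col H ≡ ∣ D π ∣
    discrepancy≡ = trans (cong (λ t → 2 ℕ.* ∣ t ∣)
        (trans (total-filter listed? (uncurry f) (cartesianProduct (allFin n) (allFin n)))
          (total-product (λ p → ⟦ listed? p ⟧ * uncurry f p))))
      (sym (trans (cong ∣_∣ D≡2W) (ℤ.abs-* (+ 2) (Σ₂ W))))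

  large-discrepancy : ∀ {n} (F : Graph n) → Graph.NoIsolatedVertices F → (f : Colouring n) →
    ∀ M → 1000 ℕ.≤ M → Graph.maxDegree F ℕ.+ M ℕ.≤ n →
    ∃ λ (H : Subgraph (complete n)) → IsCopyOf F H × suc M ℕ.≤ discrepancy f H ℕ.* 13200
  large-discrepancy {n} F no-isolated f M 1000≤M Δ+M≤n
    with π , inj , le ← Main.large-|D| F no-isolated f M 1000≤M
      (λ x → ℕ.≤-trans (ℕ.+-monoˡ-≤ M (ListAll.lookup (xs≤max 0 (map (Graph.degree F) (allFin n)))
        (∈-map⁺ (Graph.degree F) (∈-allFin x)))) Δ+M≤n)
      (fromℕ< (ℕ.≤-trans (ℕ.≤-trans (s≤s z≤n) 1000≤M) (ℕ.≤-trans (ℕ.m≤n+m M _) Δ+M≤n)))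
    = Copy.H F f π inj , Copy.isCopy F f π inj
    , ℕ.*-cancelˡ-≤ 2 (subst (2 ℕ.* suc M ℕ.≤_)
        (trans (cong (ℕ._* 13200) (sym (Copy.discrepancy≡ F f π inj))) (ℕ.*-assoc 2 (discrepancy f (Copy.H F f π inj)) 13200)) le)

open import Data.Nat.Coprimality using (Coprime)
open import Data.Rational.Base as ℚ using (ℚ; mkℚ; 0ℚ; 1ℚ; toℚᵘ; _/_; _<_; _≤_; _*_; _-_; *<*)
import Data.Rational.Properties as ℚ
open import Data.Rational.Unnormalised.Base as ℚᵘ using (mkℚᵘ; _≃_)
import Data.Rational.Unnormalised.Properties as ℚᵘ
open Combinatorics using (large-discrepancy)

-- Rational parameters and the choice of constants.

toℚᵘ-fromℕ : ∀ n → toℚᵘ (fromℕ n) ≃ mkℚᵘ (+ n) 0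
toℚᵘ-fromℕ n = ℚ.toℚᵘ-fromℚᵘ (mkℚᵘ (+ n) 0)

module _ (p q : ℕ) .(cop : Coprime p (suc q)) where

  -- Denominators are cleared in the unnormalised rationals, where sums and products compute without
  -- reduction to lowest terms.
  ≤-[1-ε]*⇒ : ∀ Δ n → fromℕ Δ ≤ (1ℚ - mkℚ (+ p) q cop) * fromℕ n → Δ ℕ.* suc q ℕ.+ p ℕ.* n ℕ.≤ n ℕ.* suc q
  ≤-[1-ε]*⇒ Δ n le = ℤ.drop‿+≤+ (subst₂ ℤ._≤_ lhs rhs (ℤ.+-monoˡ-≤ (+ p ℤ.* + n) cleared))
    where
    ε : ℚ
    ε = mkℚ (+ p) q cop
    product : toℚᵘ ((1ℚ - ε) * fromℕ n) ≃ (ℚᵘ.1ℚᵘ ℚᵘ.- toℚᵘ ε) ℚᵘ.* mkℚᵘ (+ n) 0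
    product = ℚᵘ.≃-trans (ℚ.toℚᵘ-homo-* (1ℚ - ε) (fromℕ n)) (ℚᵘ.*-cong
      (ℚᵘ.≃-trans (ℚ.toℚᵘ-homo-+ 1ℚ (ℚ.- ε)) (ℚᵘ.+-congʳ ℚᵘ.1ℚᵘ (ℚ.toℚᵘ-homo‿- ε)))
      (toℚᵘ-fromℕ n))
    cleared : + Δ ℤ.* + (1 ℕ.* suc q ℕ.* 1) ℤ.≤ (1ℤ ℤ.* + suc q ℤ.+ (ℤ.- (+ p)) ℤ.* 1ℤ) ℤ.* + n ℤ.* 1ℤ
    cleared = ℚᵘ.drop-*≤* (ℚᵘ.≤-respʳ-≃ product (ℚᵘ.≤-respˡ-≃ (toℚᵘ-fromℕ Δ) (ℚ.toℚᵘ-mono-≤ le)))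
    lhs : + Δ ℤ.* + (1 ℕ.* suc q ℕ.* 1) ℤ.+ + p ℤ.* + n ≡ + (Δ ℕ.* suc q ℕ.+ p ℕ.* n)
    lhs = cong₂ ℤ._+_ (trans (sym (ℤ.pos-* Δ (1 ℕ.* suc q ℕ.* 1)))
            (cong (λ x → + (Δ ℕ.* x)) (trans (ℕ.*-identityʳ (1 ℕ.* suc q)) (ℕ.*-identityˡ (suc q))))) (sym (ℤ.pos-* p n))
    rhs : (1ℤ ℤ.* + suc q ℤ.+ (ℤ.- (+ p)) ℤ.* 1ℤ) ℤ.* + n ℤ.* 1ℤ ℤ.+ + p ℤ.* + n ≡ + (n ℕ.* suc q)
    rhs = trans (eq (+ suc q) (+ p) (+ n)) (sym (ℤ.pos-* n (suc q)))
      where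
      eq : ∀ q p n → (1ℤ ℤ.* q ℤ.+ (ℤ.- p) ℤ.* 1ℤ) ℤ.* n ℤ.* 1ℤ ℤ.+ p ℤ.* n ≡ n ℤ.* q
      eq = solve-∀

  ⇒c*[ε*]≤ : ∀ k n d → p ℕ.* n ℕ.≤ d ℕ.* (suc k ℕ.* suc q) → + 1 / suc k * (mkℚ (+ p) q cop * fromℕ n) ≤ fromℕ d
  ⇒c*[ε*]≤ k n d le = ℚ.toℚᵘ-cancel-≤ (ℚᵘ.≤-respˡ-≃ (ℚᵘ.≃-sym product)
      (ℚᵘ.≤-respʳ-≃ (ℚᵘ.≃-sym (toℚᵘ-fromℕ d)) (ℚᵘ.*≤* cleared)))
    where
    ε : ℚ
    ε = mkℚ (+ p) q cop
    product : toℚᵘ (+ 1 / suc k * (ε * fromℕ n)) ≃ mkℚᵘ (+ 1) k ℚᵘ.* (toℚᵘ ε ℚᵘ.* mkℚᵘ (+ n) 0)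
    product = ℚᵘ.≃-trans (ℚ.toℚᵘ-homo-* (+ 1 / suc k) (ε * fromℕ n)) (ℚᵘ.*-cong (ℚ.toℚᵘ-fromℚᵘ (mkℚᵘ (+ 1) k))
      (ℚᵘ.≃-trans (ℚ.toℚᵘ-homo-* ε (fromℕ n)) (ℚᵘ.*-congˡ {toℚᵘ ε} (toℚᵘ-fromℕ n))))
    cleared : + 1 ℤ.* (+ p ℤ.* + n) ℤ.* 1ℤ ℤ.≤ + d ℤ.* + (suc k ℕ.* (suc q ℕ.* 1))
    cleared = subst₂ ℤ._≤_ (trans (ℤ.pos-* p n) (eq (+ p) (+ n)))
      (trans (cong (λ x → + (d ℕ.* (suc k ℕ.* x))) (sym (ℕ.*-identityʳ (suc q)))) (ℤ.pos-* d (suc k ℕ.* (suc q ℕ.* 1))))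
      (+≤+ le)
      where
      eq : ∀ p n → p ℤ.* n ≡ + 1 ℤ.* (p ℤ.* n) ℤ.* 1ℤ
      eq = solve-∀

theorem1p1 : ∃ λ (c : ℚ) → 0ℚ < c ×
    (∀ (ε : ℚ) → 0ℚ < ε →
    ∃ λ (n₀ : ℕ) → ∀ (n : ℕ) → n₀ ℕ.≤ n →
    (F : Graph n) →
    fromℕ (Graph.maxDegree F) ≤ (1ℚ - ε) * fromℕ n →
    Graph.NoIsolatedVertices F →
    (f : Colouring n) →
    ∃ λ (H : Subgraph (complete n)) →
    IsCopyOf F H × c * (ε * fromℕ n) ≤ fromℕ (discrepancy f H))
theorem1p1 = + 1 / 13200 , ℚ.positive⁻¹ (+ 1 / 13200) {{ℚ.normalize-pos 1 13200}} , main
  where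
  main : ∀ (ε : ℚ) → 0ℚ < ε →
    ∃ λ (n₀ : ℕ) → ∀ (n : ℕ) → n₀ ℕ.≤ n →
    (F : Graph n) →
    fromℕ (Graph.maxDegree F) ≤ (1ℚ - ε) * fromℕ n →
    Graph.NoIsolatedVertices F →
    (f : Colouring n) →
    ∃ λ (H : Subgraph (complete n)) →
    IsCopyOf F H × + 1 / 13200 * (ε * fromℕ n) ≤ fromℕ (discrepancy f H)
  main (mkℚ (+ zero) q cop) (*<* (+<+ ()))
  main (mkℚ -[1+ p ] q cop) (*<* ())
  -- A positive ε has numerator at least 1, so this threshold makes εn at least 1000.
  main (mkℚ (+ suc p) q cop) _ = 1000 ℕ.* suc q , large
    where
    large : ∀ n → 1000 ℕ.* suc q ℕ.≤ n → (F : Graph n) →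
      fromℕ (Graph.maxDegree F) ≤ (1ℚ - mkℚ (+ suc p) q cop) * fromℕ n → Graph.NoIsolatedVertices F →
      (f : Colouring n) → ∃ λ (H : Subgraph (complete n)) →
      IsCopyOf F H × + 1 / 13200 * (mkℚ (+ suc p) q cop * fromℕ n) ≤ fromℕ (discrepancy f H)
    large n n₀≤n F Δ≤ no-isolated f = copy (large-discrepancy F no-isolated f M 1000≤M Δ+M≤n)
      where
      M Δ : ℕ
      -- The integer part of εn.
      M = suc p ℕ.* n ℕ./ suc q
      Δ = Graph.maxDegree F
      1000≤M : 1000 ℕ.≤ M
      1000≤M = subst (ℕ._≤ M) (ℕ.m*n/n≡m 1000 (suc q))
        (ℕ./-monoˡ-≤ (suc q) (ℕ.≤-trans n₀≤n (ℕ.m≤m+n n (p ℕ.* n))))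
      Δ+M≤n : Δ ℕ.+ M ℕ.≤ n
      Δ+M≤n = ℕ.*-cancelʳ-≤ (Δ ℕ.+ M) n (suc q) (begin
        (Δ ℕ.+ M) ℕ.* suc q               ≡⟨ ℕ.*-distribʳ-+ (suc q) Δ M ⟩
        Δ ℕ.* suc q ℕ.+ M ℕ.* suc q       ≤⟨ ℕ.+-monoʳ-≤ (Δ ℕ.* suc q) (ℕ.m/n*n≤m (suc p ℕ.* n) (suc q)) ⟩
        Δ ℕ.* suc q ℕ.+ suc p ℕ.* n       ≤⟨ ≤-[1-ε]*⇒ (suc p) q cop Δ n Δ≤ ⟩
        n ℕ.* suc q                       ∎)
        where open ℕ.≤-Reasoning
      copy : (∃ λ (H : Subgraph (complete n)) → IsCopyOf F H × suc M ℕ.≤ discrepancy f H ℕ.* 13200) →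
             ∃ λ (H : Subgraph (complete n)) →
             IsCopyOf F H × + 1 / 13200 * (mkℚ (+ suc p) q cop * fromℕ n) ≤ fromℕ (discrepancy f H)
      -- The argument 13199 stands for the denominator 13200. The remainder is at most `suc q`, so
      -- εn is at most M + 1.
      copy (H , isCopy , M<) = H , isCopy , ⇒c*[ε*]≤ (suc p) q cop 13199 n (discrepancy f H) (begin
        suc p ℕ.* n                                          ≡⟨ ℕ.m≡m%n+[m/n]*n (suc p ℕ.* n) (suc q) ⟩
        suc p ℕ.* n ℕ.% suc q ℕ.+ M ℕ.* suc q                ≤⟨ ℕ.+-monoˡ-≤ (M ℕ.* suc q) (ℕ.<⇒≤ (ℕ.m%n<n (suc p ℕ.* n) (suc q))) ⟩
        suc M ℕ.* suc q                                      ≤⟨ ℕ.*-monoˡ-≤ (suc q) M< ⟩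
        discrepancy f H ℕ.* 13200 ℕ.* suc q                  ≡⟨ ℕ.*-assoc (discrepancy f H) 13200 (suc q) ⟩
        discrepancy f H ℕ.* (13200 ℕ.* suc q)                ∎)
        where open ℕ.≤-Reasoning
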